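{- Let $P$ be a polymatroid on $[n]$ with rank function $f$. Then (1) $x^{n-2}[\mathscr{T}_P(x,y)]=\binom{\sum_{i\in[n]}f(\{i\})-f([n])+1-n}{2}-\sum_{\{i,j\}\subset[n]}\binom{f(\{i\})+f(\{j\})-f(\{i,j\})}{2}$; (2) $y^{n-2}[\mathscr{T}_P(x,y)]=\binom{\sum_{i\in[n]}f([n]\setminus\{i\})-(n-1)f([n])+1-n}{2}-\sum_{\{i,j\}\subset[n]}\binom{f([n]\setminus\{i\})+f([n]\setminus\{j\})-f([n]\setminus\{i,j\})-f([n])}{2}$, where the sums run over two-element subsets $\{i,j\}$ of $[n]$.
   Context: A polymatroid on $[n]$ is $P=\{\mathbf a\in\mathbb{Z}^n\mid \sum_{i\in I}a_i\le f(I)\ \forall I,\ \sum_{i\in[n]}a_i=f([n])\}$ with $f(\emptyset)=0$, $f$ submodular (rank function). For $\mathbf a\in P$, $i$ is internally active if $\mathbf a-\mathbf e_i+\mathbf e_j\notin P$ for all $j<i$, externally active if $\mathbf a+\mathbf e_i-\mathbf e_j\notin P$ for all $j<i$; $\mathrm{Int}(\mathbf a),\mathrm{Ext}(\mathbf a)$ are these sets. $\mathscr{T}_P(x,y)=\sum_{\mathbf a\in P}x^{|\mathrm{Int}\setminus\mathrm{Ext}|}y^{|\mathrm{Ext}\setminus\mathrm{Int}|}(x+y-1)^{|\mathrm{Int}\cap\mathrm{Ext}|}$. $x^{i}[g]$ denotes the coefficient of $x^iy^0$ in $g$ and $y^j[g]$ the coefficient of $x^0y^j$. Binomial coefficients $\binom{m}{2}=m(m-1)/2$.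 -}

module Defs where

open import Data.Bool using (Bool; true; false; if_then_else_; not; _∧_)
open import Data.Nat as ℕ using (ℕ; zero; suc)
open import Data.Integer using (ℤ; +_; _+_; _-_; _*_; _≤_; _≤?_; _≟_; -[1+_])
open import Data.Integer.DivMod using (_/_)
open import Data.Fin using (Fin; toℕ)
import Data.Fin as Fin
open import Data.Fin.Subset using (Subset; ⊥; ⊤; ⁅_⁆; ∁; _∪_; _∩_)
open import Data.Vec using (Vec; []; _∷_; zipWith; updateAt; foldr)
open import Data.Vec.Properties using (≡-dec)
open import Data.List using (List; []; _∷_; _++_; map; concatMap; allFin; filter)
import Data.List as List
open import Data.List.Relation.Unary.All using (All)
open import Data.List.Relation.Unary.All using () renaming (all? to All?)
open import Data.List.Membership.Propositional using (_∈_)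
open import Data.List.Relation.Unary.Unique.Propositional using (Unique)
open import Data.Product using (_×_; _,_)
open import Relation.Nullary using (Dec; yes; no; ¬_)
open import Relation.Nullary.Decidable using (⌊_⌋; _×-dec_)
open import Relation.Binary.PropositionalEquality using (_≡_)
open import Function.Bundles using (_⇔_)

SetFn : ℕ → Set
SetFn n = Subset n → ℤ

IsRankFn : {n : ℕ} → SetFn n → Set
IsRankFn {n} f =
  (f ⊥ ≡ + 0) × (∀ (A B : Subset n) → f (A ∪ B) + f (A ∩ B) ≤ f A + f B)

allSubsets : (n : ℕ) → List (Subset n)
allSubsets zero = [] ∷ []
allSubsets (suc n) = map (true ∷_) (allSubsets n) ++ map (false ∷_) (allSubsets n)

subsetSum : {n : ℕ} → Vec ℤ n → Subset n → ℤ
subsetSum a I = foldr _ _+_ (+ 0) (zipWith (λ b x → if b then x else + 0) I a)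

total : {n : ℕ} → Vec ℤ n → ℤ
total a = foldr _ _+_ (+ 0) a

-- membership in the polymatroid P (integer points of the base polytope of f)
InP : {n : ℕ} → SetFn n → Vec ℤ n → Set
InP {n} f a = All (λ I → subsetSum a I ≤ f I) (allSubsets n) × (total a ≡ f ⊤)

InP? : {n : ℕ} (f : SetFn n) (a : Vec ℤ n) → Dec (InP f a)
InP? {n} f a = All? (λ I → subsetSum a I ≤? f I) (allSubsets n) ×-dec (total a ≟ f ⊤)

inP : {n : ℕ} → SetFn n → Vec ℤ n → Bool
inP f a = ⌊ InP? f a ⌋

shiftOut : {n : ℕ} → Vec ℤ n → Fin n → Fin n → Vec ℤ n
shiftOut a i j = updateAt (updateAt a i (λ x → x - + 1)) j (λ x → x + + 1)

shiftIn : {n : ℕ} → Vec ℤ n → Fin n → Fin n → Vec ℤ n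
shiftIn a i j = updateAt (updateAt a i (λ x → x + + 1)) j (λ x → x - + 1)

below : {n : ℕ} → Fin n → List (Fin n)
below {n} i = filter (λ j → toℕ j ℕ.<? toℕ i) (allFin n)

allB : {A : Set} → (A → Bool) → List A → Bool
allB p [] = true
allB p (x ∷ xs) = p x ∧ allB p xs

intAct : {n : ℕ} → SetFn n → Vec ℤ n → Fin n → Bool
intAct f a i = allB (λ j → not (inP f (shiftOut a i j))) (below i)

extAct : {n : ℕ} → SetFn n → Vec ℤ n → Fin n → Bool
extAct f a i = allB (λ j → not (inP f (shiftIn a i j))) (below i)

countB : {n : ℕ} → (Fin n → Bool) → ℕ
countB {n} p = List.length (filter (λ i → Data.Bool._≟_ (p i) true) (allFin n))
  where import Data.Bool

-- Bivariate integer polynomials as formal sums of monomials c·x^i·y^j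

record Mono : Set where
  constructor mono
  field
    coef : ℤ
    xdeg : ℕ
    ydeg : ℕ

Poly : Set
Poly = List Mono

polyOne : Poly
polyOne = mono (+ 1) 0 0 ∷ []

polyMul : Poly → Poly → Poly
polyMul p q = concatMap (λ m → map (λ m' → mono (Mono.coef m * Mono.coef m')
                                         (Mono.xdeg m ℕ.+ Mono.xdeg m')
                                         (Mono.ydeg m ℕ.+ Mono.ydeg m')) q) p

polyPow : Poly → ℕ → Poly
polyPow p zero = polyOne
polyPow p (suc k) = polyMul p (polyPow p k)

X Y : Poly
X = mono (+ 1) 1 0 ∷ []
Y = mono (+ 1) 0 1 ∷ []

XY1 : Poly
XY1 = mono (+ 1) 1 0 ∷ mono (+ 1) 0 1 ∷ mono -[1+ 0 ] 0 0 ∷ []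

coeff : ℕ → ℕ → Poly → ℤ
coeff i j [] = + 0
coeff i j (mono c a b ∷ p) =
  (if ⌊ a ℕ.≟ i ⌋ ∧ ⌊ b ℕ.≟ j ⌋ then c else + 0) + coeff i j p

coeffX : ℤ → Poly → ℤ
coeffX (+ k) g = coeff k 0 g
coeffX -[1+ _ ] g = + 0

coeffY : ℤ → Poly → ℤ
coeffY (+ k) g = coeff 0 k g
coeffY -[1+ _ ] g = + 0

-- The Tutte polynomial of P, summed over an enumeration L of P

tutteTerm : {n : ℕ} → SetFn n → Vec ℤ n → Poly
tutteTerm f a =
  polyMul (polyPow X (countB (λ i → intAct f a i ∧ not (extAct f a i))))
  (polyMul (polyPow Y (countB (λ i → extAct f a i ∧ not (intAct f a i))))
           (polyPow XY1 (countB (λ i → intAct f a i ∧ extAct f a i))))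

tutte : {n : ℕ} → SetFn n → List (Vec ℤ n) → Poly
tutte f L = concatMap (tutteTerm f) L

Enumerates : {n : ℕ} → SetFn n → List (Vec ℤ n) → Set
Enumerates {n} f L = Unique L × (∀ (a : Vec ℤ n) → (a ∈ L) ⇔ InP f a)

choose2 : ℤ → ℤ
choose2 m = (m * (m - + 1)) / + 2

sumFin : {n : ℕ} → (Fin n → ℤ) → ℤ
sumFin {n} g = List.foldr _+_ (+ 0) (map g (allFin n))

-- Σ over two-element subsets {i,j} of [n], as pairs i < j
sumPairs : {n : ℕ} → (Fin n → Fin n → ℤ) → ℤ
sumPairs {n} g =
  List.foldr _+_ (+ 0) (concatMap (λ j → map (λ i → g i j) (below j)) (allFin n))

minus1 : {n : ℕ} → Fin n → Subset n
minus1 i = ∁ ⁅ i ⁆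

minus2 : {n : ℕ} → Fin n → Fin n → Subset n
minus2 i j = ∁ (⁅ i ⁆ ∪ ⁅ j ⁆)

{-# OPTIONS --safe #-}

-- Slice P by the value k of the last coordinate. The slice P_k is again a polymatroid, with rank
-- function f_k(I) = min(f(I), f(I ∪ n) - k) and α ≤ k ≤ β, where α = f([n]) - f([n-1]), β = f(n).
-- Since activity compares an index with smaller ones only, the activities of i < n are computed in
-- P_k, while n is internally active iff k = α (uncrossing of tight sets) and externally active iff
-- k = β (duality). Hence, at y = 0,
--   T_P = x T_{P_α} + Σ_{α<k≤β} T_{P_k} - T_{P_β},
-- and, T being of degree n, the coefficients of xⁿ, xⁿ⁻¹, xⁿ⁻² follow in turn by induction on n.
-- The second formula is the first one for the dual polymatroid -P.
module Submission where

open import Defs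
open import Algebra.Lattice.Properties.BooleanAlgebra as BooleanAlgebra using ()
open import Data.Bool using (Bool; true; false; if_then_else_; not; _∧_; _∨_)
import Data.Bool.Properties as Bool
open import Data.Fin using (Fin; zero; suc; toℕ; fromℕ; inject₁)
open import Data.Fin.Properties using (toℕ-inject₁; toℕ-fromℕ; inject₁ℕ<)
open import Data.Fin.Subset using (Subset; ⊤; ⊥; ⁅_⁆; ∁; _∪_; _∩_)
open import Data.Fin.Subset.Properties using (∪-∩-booleanAlgebra)
open import Data.Integer hiding (suc; NonZero)
open import Data.Integer.DivMod using (_/_; _%_; a≡a%n+[a/n]*n; n%d<d)
open import Data.Integer.Properties
open import Data.Integer.Tactic.RingSolver using (solve-∀)
open import Data.List as List using (List; []; _∷_; _++_; map; concatMap; foldr; filter; allFin; length)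
import Data.List.Properties as List
open import Data.List.Membership.Propositional using (_∈_)
open import Data.List.Membership.Propositional.Properties
  using (∈-++⁺ˡ; ∈-++⁺ʳ; ∈-map⁺; ∈-map⁻; ∈-allFin; ∈-filter⁺; ∈-filter⁻)
open import Data.List.Relation.Unary.All as All using (All; []; _∷_)
open import Data.List.Relation.Unary.All.Properties using (¬All⇒Any¬; map⁺)
open import Data.List.Relation.Unary.AllPairs using ([]; _∷_)
open import Data.List.Relation.Unary.Any using (here; there; satisfied)
open import Data.List.Relation.Unary.Unique.Propositional using (Unique)
import Data.List.Relation.Unary.Unique.Propositional.Properties as Unique
open import Data.Nat as ℕ using (ℕ; zero; suc; _≡ᵇ_)
import Data.Nat.Properties as ℕ
open import Data.Product using (_×_; _,_; proj₁; proj₂; ∃)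
open import Data.Sum using (inj₁; inj₂)
open import Data.Vec as Vec using (Vec; []; _∷_; _∷ʳ_; lookup; updateAt; replicate; zipWith; initLast)
open import Data.Vec.Properties as Vec
  using (map-updateAt; lookup-zipWith; map-∷ʳ; init-∷ʳ; last-∷ʳ; map-replicate)
open import Function using (_∘_; _⇔_; mk⇔; Equivalence)
open import Relation.Binary.PropositionalEquality
open import Relation.Nullary using (Dec; yes; no; ¬_; contradiction)
open import Relation.Nullary.Decidable using (⌊_⌋; isYes≗does; does-⇔; does)
open import Relation.Unary using (Decidable)
open ≡-Reasoning

-- In the recursion the coefficient of `xⁿ⁻²` requires the corresponding coefficient (exponent two
-- below the dimension) only from the slice at α. There `f_α(I) = f(I)`, so the binomials of the
-- pairs that avoid the last index are inherited unchanged. The other slices enter with the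
-- coefficient one below their leading one, which is linear in the ranks of singletons and of the
-- whole set.
--
-- The new binomials come from summing these singleton ranks over the slices. As k descends from β,
-- `f_k({i}) = min(f({i}), f({i,n}) - k)` climbs by one for `f({i}) + f({n}) - f({i,n})` steps and
-- is constant afterwards. The deficit of this ramp against the constant is a triangular number, and
-- it is exactly the binomial of the pair `{i,n}`.
--
-- Exponents are integers throughout, with coefficient 0 at negative ones. The recursion then holds
-- for every exponent, and the induction can start at dimension 0, where the polynomial is 1.

interchange : ∀ a b c d → (a + b) + (c + d) ≡ (a + c) + (b + d)
interchange = solve-∀

-- Sums over lists

sumBy : {A : Set} → (A → ℤ) → List A → ℤ
sumBy g xs = foldr _+_ (+ 0) (map g xs)

module _ {A : Set} where

  sumBy-cong∈ : {g h : A → ℤ} (xs : List A) → (∀ {x} → x ∈ xs → g x ≡ h x) → sumBy g xs ≡ sumBy h xs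
  sumBy-cong∈ []       eq = refl
  sumBy-cong∈ (x ∷ xs) eq = cong₂ _+_ (eq (here refl)) (sumBy-cong∈ xs (eq ∘ there))

  sumBy-cong : {g h : A → ℤ} (xs : List A) → (∀ x → g x ≡ h x) → sumBy g xs ≡ sumBy h xs
  sumBy-cong xs eq = sumBy-cong∈ xs (λ {x} _ → eq x)

  sumBy-++ : (g : A → ℤ) (xs ys : List A) → sumBy g (xs ++ ys) ≡ sumBy g xs + sumBy g ys
  sumBy-++ g []       ys = sym (+-identityˡ _)
  sumBy-++ g (x ∷ xs) ys =
    trans (cong (_+_ (g x)) (sumBy-++ g xs ys)) (sym (+-assoc (g x) _ _))

  sumBy-0 : (xs : List A) → sumBy (λ _ → + 0) xs ≡ + 0
  sumBy-0 []       = refl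
  sumBy-0 (x ∷ xs) = trans (+-identityˡ _) (sumBy-0 xs)

  sumBy-+ : (g h : A → ℤ) (xs : List A) → sumBy (λ x → g x + h x) xs ≡ sumBy g xs + sumBy h xs
  sumBy-+ g h []       = refl
  sumBy-+ g h (x ∷ xs) = trans (cong (_+_ (g x + h x)) (sumBy-+ g h xs))
    (interchange (g x) (h x) (sumBy g xs) (sumBy h xs))

  sumBy-neg : (g : A → ℤ) (xs : List A) → sumBy (λ x → - g x) xs ≡ - sumBy g xs
  sumBy-neg g []       = refl
  sumBy-neg g (x ∷ xs) =
    trans (cong (_+_ (- g x)) (sumBy-neg g xs)) (sym (neg-distrib-+ (g x) _))

  sumBy-map : {B : Set} (g : A → ℤ) (h : B → A) (xs : List B) → sumBy g (map h xs) ≡ sumBy (g ∘ h) xs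
  sumBy-map g h xs = cong (foldr _+_ (+ 0)) (sym (List.map-∘ xs))

  sumBy-concatMap : {B : Set} (g : A → ℤ) (h : B → List A) (xs : List B) →
    sumBy g (concatMap h xs) ≡ sumBy (sumBy g ∘ h) xs
  sumBy-concatMap g h []       = refl
  sumBy-concatMap g h (x ∷ xs) =
    trans (sumBy-++ g (h x) _) (cong (_+_ (sumBy g (h x))) (sumBy-concatMap g h xs))

-- Coefficients of xᵖ yᵉ (x + y - 1)ᵇ

monoX monoY : ℤ → Mono → ℤ
monoX (+ k)    (mono c a b) = if (a ≡ᵇ k) ∧ (b ≡ᵇ 0) then c else + 0
monoX -[1+ _ ] _            = + 0
monoY z (mono c a b) = monoX z (mono c b a)

coeffX-sum : ∀ z g → coeffX z g ≡ sumBy (monoX z) g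
coeffX-sum (+ k)    []               = refl
coeffX-sum (+ k)    (mono c a b ∷ g) = cong₂ _+_
  (cong₂ (λ u v → if u ∧ v then c else + 0) (isYes≗does (a ℕ.≟ k)) (isYes≗does (b ℕ.≟ 0)))
  (coeffX-sum (+ k) g)
coeffX-sum -[1+ k ] g                = sym (sumBy-0 g)

coeffY-sum : ∀ z g → coeffY z g ≡ sumBy (monoY z) g
coeffY-sum (+ k)    []               = refl
coeffY-sum (+ k)    (mono c a b ∷ g) = cong₂ _+_
  (cong (if_then c else + 0) (trans
    (cong₂ _∧_ (isYes≗does (a ℕ.≟ 0)) (isYes≗does (b ℕ.≟ k))) (Bool.∧-comm (a ≡ᵇ 0) (b ≡ᵇ k))))
  (coeffY-sum (+ k) g)
coeffY-sum -[1+ k ] g                = sym (sumBy-0 g)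

-- Division by `x` lowers the exponent without a side condition: at `z = 0` the right side asks for
-- exponent -1, where `monoX` is 0, in agreement with a multiple of `x` having no constant term.
monoX-X : ∀ z c a b → monoX z (mono c (suc a) b) ≡ monoX (z - + 1) (mono c a b)
monoX-X (+ zero)  c a b = refl
monoX-X (+ suc k) c a b = cong (λ z → monoX z (mono c a b)) (sym (m-n≡m⊖n (suc k) 1))
monoX-X -[1+ k ]  c a b = refl

monoX-Y : ∀ z c a b → monoX z (mono c a (suc b)) ≡ + 0
monoX-Y (+ k)    c a b = cong (if_then c else + 0) (Bool.∧-comm (a ≡ᵇ k) false)
monoX-Y -[1+ k ] c a b = refl

monoX-neg : ∀ z c a b → monoX z (mono (- c) a b) ≡ - monoX z (mono c a b)
monoX-neg (+ k)    c a b with (a ≡ᵇ k) ∧ (b ≡ᵇ 0)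
... | true  = refl
... | false = refl
monoX-neg -[1+ k ] c a b = refl

-- `tutteTerm f a` unfolds to an instance of this, so a point enters the polynomial only through
-- three counts of indices.
term : ℕ → ℕ → ℕ → Poly
term p e b = polyMul (polyPow X p) (polyMul (polyPow Y e) (polyPow XY1 b))

polyPow-X : ∀ p → polyPow X p ≡ mono (+ 1) p 0 ∷ []
polyPow-X zero    = refl
polyPow-X (suc p) rewrite polyPow-X p = refl

polyPow-Y : ∀ e → polyPow Y e ≡ mono (+ 1) 0 e ∷ []
polyPow-Y zero    = refl
polyPow-Y (suc e) rewrite polyPow-Y e = refl

-- For a coefficient functional `ψ` this is its value on `xᵖ yᵉ (x + y - 1)ᵇ`. Polynomials are
-- unsimplified lists of monomials, so the identities wanted hold only after a functional has been
-- applied; leaving `ψ` open serves `monoX` and `monoY` alike.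
shifted : (Mono → ℤ) → ℕ → ℕ → ℕ → ℤ
shifted ψ p e b =
  sumBy (λ m → ψ (mono (Mono.coef m) (p ℕ.+ Mono.xdeg m) (e ℕ.+ Mono.ydeg m))) (polyPow XY1 b)

times : Mono → Mono → Mono
times m m′ = mono (Mono.coef m * Mono.coef m′)
  (Mono.xdeg m ℕ.+ Mono.xdeg m′) (Mono.ydeg m ℕ.+ Mono.ydeg m′)

sumBy-polyMul : ∀ ψ p q → sumBy ψ (polyMul p q) ≡ sumBy (λ m → sumBy (ψ ∘ times m) q) p
sumBy-polyMul ψ p q = trans (sumBy-concatMap ψ (λ m → map (times m) q) p)
  (sumBy-cong p (λ m → sumBy-map ψ (times m) q))

shifted-term : ∀ ψ p e b → sumBy ψ (term p e b) ≡ shifted ψ p e b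
shifted-term ψ p e b rewrite polyPow-X p | polyPow-Y e = begin
  sumBy ψ (polyMul (mono (+ 1) p 0 ∷ []) (polyMul (mono (+ 1) 0 e ∷ []) R))
    ≡⟨ sumBy-polyMul ψ (mono (+ 1) p 0 ∷ []) (polyMul (mono (+ 1) 0 e ∷ []) R) ⟩
  sumBy (ψ ∘ times (mono (+ 1) p 0)) (polyMul (mono (+ 1) 0 e ∷ []) R) + + 0
    ≡⟨ +-identityʳ _ ⟩
  sumBy (ψ ∘ times (mono (+ 1) p 0)) (polyMul (mono (+ 1) 0 e ∷ []) R)
    ≡⟨ sumBy-polyMul (ψ ∘ times (mono (+ 1) p 0)) (mono (+ 1) 0 e ∷ []) R ⟩
  sumBy (ψ ∘ times (mono (+ 1) p 0) ∘ times (mono (+ 1) 0 e)) R + + 0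
    ≡⟨ +-identityʳ _ ⟩
  sumBy (ψ ∘ times (mono (+ 1) p 0) ∘ times (mono (+ 1) 0 e)) R
    ≡⟨ sumBy-cong R unit ⟩
  shifted ψ p e b ∎
  where
  R = polyPow XY1 b
  unit : ∀ m → ψ (times (mono (+ 1) p 0) (times (mono (+ 1) 0 e) m))
             ≡ ψ (mono (Mono.coef m) (p ℕ.+ Mono.xdeg m) (e ℕ.+ Mono.ydeg m))
  unit m = cong (λ c → ψ (mono c (p ℕ.+ Mono.xdeg m) (e ℕ.+ Mono.ydeg m)))
    (trans (*-identityˡ (+ 1 * Mono.coef m)) (*-identityˡ (Mono.coef m)))

-- One factor `x + y - 1` is multiplied out. Its coefficients are 1 and -1, so compatibility with
-- sign is the part of linearity that enters.
shifted-XY1 : ∀ ψ → (∀ c a b → ψ (mono (- c) a b) ≡ - ψ (mono c a b)) → ∀ p e b →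
  shifted ψ p e (suc b) ≡ shifted ψ (suc p) e b + shifted ψ p (suc e) b - shifted ψ p e b
shifted-XY1 ψ ψ-neg p e b = begin
  sumBy ψ′ (polyMul XY1 R)
    ≡⟨ sumBy-polyMul ψ′ XY1 R ⟩
  sumBy (ψ′ ∘ times (mono (+ 1) 1 0)) R
    + (sumBy (ψ′ ∘ times (mono (+ 1) 0 1)) R + (sumBy (ψ′ ∘ times (mono -[1+ 0 ] 0 0)) R + + 0))
    ≡⟨ cong₂ _+_ byX (cong₂ _+_ byY (cong (_+ + 0) by-1)) ⟩
  sx + (sy + (- s + + 0))
    ≡⟨ reassoc sx sy s ⟩
  sx + sy - s ∎
  where
  R  = polyPow XY1 b
  ψ′ : Mono → ℤ
  ψ′ m = ψ (mono (Mono.coef m) (p ℕ.+ Mono.xdeg m) (e ℕ.+ Mono.ydeg m))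
  sx = shifted ψ (suc p) e b
  sy = shifted ψ p (suc e) b
  s  = shifted ψ p e b
  reassoc : ∀ x y z → x + (y + (- z + + 0)) ≡ x + y - z
  reassoc = solve-∀
  byX : sumBy (ψ′ ∘ times (mono (+ 1) 1 0)) R ≡ sx
  byX = sumBy-cong R λ m →
    cong₂ (λ c a → ψ (mono c a (e ℕ.+ Mono.ydeg m))) (*-identityˡ (Mono.coef m)) (ℕ.+-suc p (Mono.xdeg m))
  byY : sumBy (ψ′ ∘ times (mono (+ 1) 0 1)) R ≡ sy
  byY = sumBy-cong R λ m →
    cong₂ (λ c a → ψ (mono c (p ℕ.+ Mono.xdeg m) a)) (*-identityˡ (Mono.coef m)) (ℕ.+-suc e (Mono.ydeg m))
  by-1 : sumBy (ψ′ ∘ times (mono -[1+ 0 ] 0 0)) R ≡ - s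
  by-1 = trans
    (sumBy-cong R λ m → trans
      (cong (λ c → ψ (mono c (p ℕ.+ Mono.xdeg m) (e ℕ.+ Mono.ydeg m))) (-1*i≡-i (Mono.coef m)))
      (ψ-neg (Mono.coef m) (p ℕ.+ Mono.xdeg m) (e ℕ.+ Mono.ydeg m)))
    (sumBy-neg ψ′ R)

coeffX-term : ∀ z p e b → coeffX z (term p e b) ≡ shifted (monoX z) p e b
coeffX-term z p e b = trans (coeffX-sum z (term p e b)) (shifted-term (monoX z) p e b)

coeffX-term-X : ∀ z p e b → coeffX z (term (suc p) e b) ≡ coeffX (z - + 1) (term p e b)
coeffX-term-X z p e b = begin
  coeffX z (term (suc p) e b)       ≡⟨ coeffX-term z (suc p) e b ⟩
  shifted (monoX z) (suc p) e b     ≡⟨ sumBy-cong (polyPow XY1 b) (λ m → monoX-X z _ _ _) ⟩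
  shifted (monoX (z - + 1)) p e b   ≡⟨ coeffX-term (z - + 1) p e b ⟨
  coeffX (z - + 1) (term p e b)     ∎

coeffX-term-Y : ∀ z p e b → coeffX z (term p (suc e) b) ≡ + 0
coeffX-term-Y z p e b = begin
  coeffX z (term p (suc e) b)         ≡⟨ coeffX-term z p (suc e) b ⟩
  shifted (monoX z) p (suc e) b       ≡⟨ sumBy-cong (polyPow XY1 b) (λ m → monoX-Y z _ _ _) ⟩
  sumBy (λ _ → + 0) (polyPow XY1 b)   ≡⟨ sumBy-0 (polyPow XY1 b) ⟩
  + 0                                 ∎

coeffX-term-XY1 : ∀ z p e b →
  coeffX z (term p e (suc b)) ≡ coeffX (z - + 1) (term p e b) - coeffX z (term p e b)
coeffX-term-XY1 z p e b = begin
  coeffX z (term p e (suc b))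
    ≡⟨ coeffX-term z p e (suc b) ⟩
  shifted (monoX z) p e (suc b)
    ≡⟨ shifted-XY1 (monoX z) (monoX-neg z) p e b ⟩
  shifted (monoX z) (suc p) e b + shifted (monoX z) p (suc e) b - shifted (monoX z) p e b
    ≡⟨ cong₂ _-_ (cong₂ _+_ (coeffX-term z (suc p) e b) (coeffX-term z p (suc e) b))
                 (coeffX-term z p e b) ⟨
  coeffX z (term (suc p) e b) + coeffX z (term p (suc e) b) - coeffX z (term p e b)
    ≡⟨ cong (_- coeffX z (term p e b))
         (trans (cong₂ _+_ (coeffX-term-X z p e b) (coeffX-term-Y z p e b))
           (+-identityʳ (coeffX (z - + 1) (term p e b)))) ⟩
  coeffX (z - + 1) (term p e b) - coeffX z (term p e b) ∎

-- The expansion of `(x + y - 1)ᵇ` as a list is not symmetric in the two variables. The symmetry is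
-- therefore proved for the functionals, by induction on `b` through `shifted-XY1`.
coeffY-term : ∀ z p e b → coeffY z (term p e b) ≡ coeffX z (term e p b)
coeffY-term z p e b = begin
  coeffY z (term p e b)      ≡⟨ coeffY-sum z (term p e b) ⟩
  sumBy (monoY z) (term p e b) ≡⟨ shifted-term (monoY z) p e b ⟩
  shifted (monoY z) p e b    ≡⟨ swap p e b ⟩
  shifted (monoX z) e p b    ≡⟨ coeffX-term z e p b ⟨
  coeffX z (term e p b)      ∎
  where
  swap : ∀ p e b → shifted (monoY z) p e b ≡ shifted (monoX z) e p b
  swap p e zero    = refl
  swap p e (suc b) = begin
    shifted (monoY z) p e (suc b)
      ≡⟨ shifted-XY1 (monoY z) (λ c i j → monoX-neg z c j i) p e b ⟩
    shifted (monoY z) (suc p) e b + shifted (monoY z) p (suc e) b - shifted (monoY z) p e b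
      ≡⟨ cong₂ _-_ (cong₂ _+_ (swap (suc p) e b) (swap p (suc e) b)) (swap p e b) ⟩
    shifted (monoX z) e (suc p) b + shifted (monoX z) (suc e) p b - shifted (monoX z) e p b
      ≡⟨ cong (_- shifted (monoX z) e p b) (+-comm (shifted (monoX z) e (suc p) b) _) ⟩
    shifted (monoX z) (suc e) p b + shifted (monoX z) e (suc p) b - shifted (monoX z) e p b
      ≡⟨ shifted-XY1 (monoX z) (monoX-neg z) e p b ⟨
    shifted (monoX z) e p (suc b) ∎

coeffX-tutte : ∀ {n} z (f : SetFn n) L → coeffX z (tutte f L) ≡ sumBy (coeffX z ∘ tutteTerm f) L
coeffX-tutte z f L = begin
  coeffX z (tutte f L)                     ≡⟨ coeffX-sum z (tutte f L) ⟩
  sumBy (monoX z) (tutte f L)              ≡⟨ sumBy-concatMap (monoX z) (tutteTerm f) L ⟩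
  sumBy (sumBy (monoX z) ∘ tutteTerm f) L  ≡⟨ sumBy-cong L (λ a → coeffX-sum z (tutteTerm f a)) ⟨
  sumBy (coeffX z ∘ tutteTerm f) L         ∎

coeffY-tutte : ∀ {n} z (f : SetFn n) L → coeffY z (tutte f L) ≡ sumBy (coeffY z ∘ tutteTerm f) L
coeffY-tutte z f L = begin
  coeffY z (tutte f L)                     ≡⟨ coeffY-sum z (tutte f L) ⟩
  sumBy (monoY z) (tutte f L)              ≡⟨ sumBy-concatMap (monoY z) (tutteTerm f) L ⟩
  sumBy (sumBy (monoY z) ∘ tutteTerm f) L  ≡⟨ sumBy-cong L (λ a → coeffY-sum z (tutteTerm f a)) ⟨
  sumBy (coeffY z ∘ tutteTerm f) L         ∎

-- Reduces an inequality to a known one and an equation between the two differences, which is a ring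
-- identity for the solver. The local lemmas called `shift` and `diff` are mostly such identities.
≤-linear : ∀ {a b c d} → c ≤ d → b - a ≡ d - c → a ≤ b
≤-linear c≤d eq = 0≤i-j⇒j≤i (subst (+ 0 ≤_) (sym eq) (i≤j⇒0≤j-i c≤d))

-- Vectors, subsets and a(I) seen from the last coordinate

zipWith-∷ʳ : {A B C : Set} (g : A → B → C) {n : ℕ} (xs : Vec A n) (ys : Vec B n) (x : A) (y : B) →
  zipWith g (xs ∷ʳ x) (ys ∷ʳ y) ≡ zipWith g xs ys ∷ʳ g x y
zipWith-∷ʳ g []       []       x y = refl
zipWith-∷ʳ g (u ∷ xs) (v ∷ ys) x y = cong (g u v ∷_) (zipWith-∷ʳ g xs ys x y)

replicate-∷ʳ : {A : Set} (n : ℕ) (x : A) → replicate (suc n) x ≡ replicate n x ∷ʳ x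
replicate-∷ʳ zero    x = refl
replicate-∷ʳ (suc n) x = cong (x ∷_) (replicate-∷ʳ n x)

⁅inject₁⁆ : ∀ {n} (i : Fin n) → ⁅ inject₁ i ⁆ ≡ ⁅ i ⁆ ∷ʳ false
⁅inject₁⁆ zero    = cong (true ∷_) (replicate-∷ʳ _ false)
⁅inject₁⁆ (suc i) = cong (false ∷_) (⁅inject₁⁆ i)

⁅fromℕ⁆ : ∀ n → ⁅ fromℕ n ⁆ ≡ ⊥ ∷ʳ true
⁅fromℕ⁆ zero    = refl
⁅fromℕ⁆ (suc n) = cong (false ∷_) (⁅fromℕ⁆ n)

updateAt-inject₁ : {A : Set} {n : ℕ} (xs : Vec A n) (x : A) (i : Fin n) (g : A → A) →
  updateAt (xs ∷ʳ x) (inject₁ i) g ≡ updateAt xs i g ∷ʳ x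
updateAt-inject₁ (y ∷ xs) x zero    g = refl
updateAt-inject₁ (y ∷ xs) x (suc i) g = cong (y ∷_) (updateAt-inject₁ xs x i g)

updateAt-fromℕ : {A : Set} {n : ℕ} (xs : Vec A n) (x : A) (g : A → A) →
  updateAt (xs ∷ʳ x) (fromℕ n) g ≡ xs ∷ʳ g x
updateAt-fromℕ []       x g = refl
updateAt-fromℕ (y ∷ xs) x g = cong (y ∷_) (updateAt-fromℕ xs x g)

lookup-true⇒⊤ : ∀ {n} (J : Subset n) → (∀ i → lookup J i ≡ true) → J ≡ ⊤
lookup-true⇒⊤ []      eq = refl
lookup-true⇒⊤ (x ∷ J) eq = cong₂ _∷_ (eq zero) (lookup-true⇒⊤ J (eq ∘ suc))

subsetSum-∷ʳ : ∀ {n} (a : Vec ℤ n) k (I : Subset n) b →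
  subsetSum (a ∷ʳ k) (I ∷ʳ b) ≡ subsetSum a I + (if b then k else + 0)
subsetSum-∷ʳ []      k []      b = +-comm (if b then k else + 0) (+ 0)
subsetSum-∷ʳ (x ∷ a) k (c ∷ I) b =
  trans (cong (_+_ (if c then x else + 0)) (subsetSum-∷ʳ a k I b))
        (sym (+-assoc (if c then x else + 0) _ _))

subsetSum-⊤ : ∀ {n} (a : Vec ℤ n) → subsetSum a ⊤ ≡ total a
subsetSum-⊤ []      = refl
subsetSum-⊤ (x ∷ a) = cong (_+_ x) (subsetSum-⊤ a)

subsetSum-⊥ : ∀ {n} (a : Vec ℤ n) → subsetSum a ⊥ ≡ + 0
subsetSum-⊥ []      = refl
subsetSum-⊥ (x ∷ a) = trans (+-identityˡ _) (subsetSum-⊥ a)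

total-∷ʳ : ∀ {n} (a : Vec ℤ n) k → total (a ∷ʳ k) ≡ total a + k
total-∷ʳ []      k = +-comm k (+ 0)
total-∷ʳ (x ∷ a) k = trans (cong (_+_ x) (total-∷ʳ a k)) (sym (+-assoc x _ _))

subsetSum-modular : ∀ {n} (a : Vec ℤ n) (I J : Subset n) →
  subsetSum a (I ∪ J) + subsetSum a (I ∩ J) ≡ subsetSum a I + subsetSum a J
subsetSum-modular []      []      []      = refl
subsetSum-modular (x ∷ a) (b ∷ I) (c ∷ J) =
  trans (interchange (if b ∨ c then x else + 0) (subsetSum a (I ∪ J)) (if b ∧ c then x else + 0) (subsetSum a (I ∩ J)))
  (trans (cong₂ _+_ (bits b c) (subsetSum-modular a I J))
         (interchange (if b then x else + 0) (if c then x else + 0) (subsetSum a I) (subsetSum a J)))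
  where
  bits : ∀ b c → (if b ∨ c then x else + 0) + (if b ∧ c then x else + 0)
               ≡ (if b then x else + 0) + (if c then x else + 0)
  bits true  true  = refl
  bits true  false = refl
  bits false true  = +-comm x (+ 0)
  bits false false = refl

subsetSum-∁ : ∀ {n} (a : Vec ℤ n) (I : Subset n) →
  subsetSum (Vec.map -_ a) I ≡ subsetSum a (∁ I) - total a
subsetSum-∁ []      []      = refl
subsetSum-∁ (x ∷ a) (b ∷ I) =
  trans (cong (_+_ (if b then - x else + 0)) (subsetSum-∁ a I))
        (bit b x (subsetSum a (∁ I)) (total a))
  where
  bit : ∀ b x s t → (if b then - x else + 0) + (s - t) ≡ ((if not b then x else + 0) + s) - (x + t)
  bit true  = bit₁
    where
    bit₁ : ∀ x s t → - x + (s - t) ≡ (+ 0 + s) - (x + t)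
    bit₁ = solve-∀
  bit false = bit₀
    where
    bit₀ : ∀ x s t → + 0 + (s - t) ≡ (x + s) - (x + t)
    bit₀ = solve-∀

total-neg : ∀ {n} (a : Vec ℤ n) → total (Vec.map -_ a) ≡ - total a
total-neg []      = refl
total-neg (x ∷ a) = trans (cong (_+_ (- x)) (total-neg a)) (sym (neg-distrib-+ x _))

subsetSum-increment : ∀ {n} (a : Vec ℤ n) (j : Fin n) (I : Subset n) →
  subsetSum (updateAt a j (_+ + 1)) I ≡ subsetSum a I + (if lookup I j then + 1 else + 0)
subsetSum-increment (x ∷ a) zero (b ∷ I) = bit b x (subsetSum a I)
  where
  bit : ∀ b x s → (if b then x + + 1 else + 0) + s
                ≡ ((if b then x else + 0) + s) + (if b then + 1 else + 0)
  bit true  = bit₁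
    where
    bit₁ : ∀ x s → x + + 1 + s ≡ (x + s) + + 1
    bit₁ = solve-∀
  bit false = bit₀
    where
    bit₀ : ∀ (x s : ℤ) → + 0 + s ≡ (+ 0 + s) + + 0
    bit₀ = solve-∀
subsetSum-increment (x ∷ a) (suc j) (b ∷ I) =
  trans (cong (_+_ (if b then x else + 0)) (subsetSum-increment a j I))
        (sym (+-assoc (if b then x else + 0) _ _))

total-increment : ∀ {n} (a : Vec ℤ n) (j : Fin n) → total (updateAt a j (_+ + 1)) ≡ total a + + 1
total-increment (x ∷ a) zero    = swap x (total a)
  where
  swap : ∀ x s → x + + 1 + s ≡ x + s + + 1
  swap = solve-∀
total-increment (x ∷ a) (suc j) =
  trans (cong (_+_ x) (total-increment a j)) (sym (+-assoc x _ _))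

-- Polymatroids, and the slices with prescribed last coordinate

∈-allSubsets : ∀ {n} (I : Subset n) → I ∈ allSubsets n
∈-allSubsets []          = here refl
∈-allSubsets (true  ∷ I) = ∈-++⁺ˡ (∈-map⁺ (true ∷_) (∈-allSubsets I))
∈-allSubsets (false ∷ I) = ∈-++⁺ʳ _ (∈-map⁺ (false ∷_) (∈-allSubsets I))

InP⇒≤ : ∀ {n} {f : SetFn n} {a} → InP f a → ∀ I → subsetSum a I ≤ f I
InP⇒≤ (ineq , _) I = All.lookup ineq (∈-allSubsets I)

≤⇒InP : ∀ {n} {f : SetFn n} {a} → (∀ I → subsetSum a I ≤ f I) → total a ≡ f ⊤ → InP f a
≤⇒InP ineq eq = All.tabulate (λ {I} _ → ineq I) , eq

¬InP⇒violated : ∀ {n} {f : SetFn n} {a} → total a ≡ f ⊤ → ¬ InP f a → ∃ λ I → f I < subsetSum a I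
¬InP⇒violated {n} {f} {a} eq a∉P
  with satisfied (¬All⇒Any¬ (λ I → subsetSum a I ≤? f I) (allSubsets n) (λ ineq → a∉P (ineq , eq)))
... | I , ≰ = I , ≰⇒> ≰

inP-cong : ∀ {m n} {f : SetFn m} {g : SetFn n} {a b} → InP f a ⇔ InP g b → inP f a ≡ inP g b
inP-cong {f = f} {g} {a} {b} eqv =
  trans (isYes≗does (InP? f a)) (trans (does-⇔ eqv (InP? f a) (InP? g b)) (sym (isYes≗does (InP? g b))))

slice : ∀ {n} → SetFn (suc n) → ℤ → SetFn n
slice f k I = f (I ∷ʳ false) ⊓ (f (I ∷ʳ true) - k)

lowest highest : ∀ {n} → SetFn (suc n) → ℤ
lowest  f = f ⊤ - f (⊤ ∷ʳ false)
highest f = f (⊥ ∷ʳ true)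

module _ {n : ℕ} {f : SetFn (suc n)} (rank : IsRankFn f) where

  f-⊥ : f (⊥ ∷ʳ false) ≡ + 0
  f-⊥ = trans (cong f (sym (replicate-∷ʳ n false))) (proj₁ rank)

  f-⊤ : f (⊤ ∷ʳ true) ≡ f ⊤
  f-⊤ = cong f (sym (replicate-∷ʳ n true))

  submodular-∷ʳ : ∀ I J b c →
    f ((I ∪ J) ∷ʳ (b ∨ c)) + f ((I ∩ J) ∷ʳ (b ∧ c)) ≤ f (I ∷ʳ b) + f (J ∷ʳ c)
  submodular-∷ʳ I J b c = subst₂ (λ U V → f U + f V ≤ f (I ∷ʳ b) + f (J ∷ʳ c))
    (zipWith-∷ʳ _∨_ I J b c) (zipWith-∷ʳ _∧_ I J b c) (proj₂ rank (I ∷ʳ b) (J ∷ʳ c))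

  module _ {k : ℤ} where

    slice≤₀ : ∀ I → slice f k I ≤ f (I ∷ʳ false)
    slice≤₀ I = i⊓j≤i (f (I ∷ʳ false)) (f (I ∷ʳ true) - k)

    slice≤₁ : ∀ I → slice f k I ≤ f (I ∷ʳ true) - k
    slice≤₁ I = i⊓j≤j (f (I ∷ʳ false)) (f (I ∷ʳ true) - k)

    -- At `I` and `J` the term attaining the minimum is taken, which decides whether the last index
    -- is adjoined to each. At the union and the intersection the minimum is bounded by the term
    -- with the matching choice: adjoined to the union if either set has it, to the intersection if
    -- both do. Then `k` is subtracted equally often on both sides, and submodularity of `f`
    -- remains.
    slice-submodular : ∀ I J → slice f k (I ∪ J) + slice f k (I ∩ J) ≤ slice f k I + slice f k J
    slice-submodular I J with ⊓-sel (f (I ∷ʳ false)) (f (I ∷ʳ true) - k)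
                            | ⊓-sel (f (J ∷ʳ false)) (f (J ∷ʳ true) - k)
    ... | inj₁ p | inj₁ q rewrite p | q =
      ≤-trans (+-mono-≤ (slice≤₀ (I ∪ J)) (slice≤₀ (I ∩ J))) (submodular-∷ʳ I J false false)
    ... | inj₁ p | inj₂ q rewrite p | q =
      ≤-trans (+-mono-≤ (slice≤₁ (I ∪ J)) (slice≤₀ (I ∩ J))) (≤-linear (submodular-∷ʳ I J false true)
        (shift (f ((I ∪ J) ∷ʳ true)) (f ((I ∩ J) ∷ʳ false)) (f (I ∷ʳ false)) (f (J ∷ʳ true)) k))
      where
      shift : ∀ u v x y k → x + (y - k) - (u - k + v) ≡ x + y - (u + v)
      shift = solve-∀
    ... | inj₂ p | inj₁ q rewrite p | q =
      ≤-trans (+-mono-≤ (slice≤₁ (I ∪ J)) (slice≤₀ (I ∩ J))) (≤-linear (submodular-∷ʳ I J true false)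
        (shift (f ((I ∪ J) ∷ʳ true)) (f ((I ∩ J) ∷ʳ false)) (f (I ∷ʳ true)) (f (J ∷ʳ false)) k))
      where
      shift : ∀ u v x y k → (x - k) + y - (u - k + v) ≡ x + y - (u + v)
      shift = solve-∀
    ... | inj₂ p | inj₂ q rewrite p | q =
      ≤-trans (+-mono-≤ (slice≤₁ (I ∪ J)) (slice≤₁ (I ∩ J))) (≤-linear (submodular-∷ʳ I J true true)
        (shift (f ((I ∪ J) ∷ʳ true)) (f ((I ∩ J) ∷ʳ true)) (f (I ∷ʳ true)) (f (J ∷ʳ true)) k))
      where
      shift : ∀ u v x y k → (x - k) + (y - k) - ((u - k) + (v - k)) ≡ x + y - (u + v)
      shift = solve-∀

    -- The two bounds on `k` have separate duties: `lowest f ≤ k` gives the slice the right total,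
    -- and `k ≤ highest f` gives its rank function the value 0 at `⊥`.
    slice-⊤ : lowest f ≤ k → slice f k ⊤ ≡ f ⊤ - k
    slice-⊤ α≤k rewrite f-⊤ = i≥j⇒i⊓j≡j (≤-linear α≤k (shift (f (⊤ ∷ʳ false)) (f ⊤) k))
      where
      shift : ∀ q r k → q - (r - k) ≡ k - (r - q)
      shift = solve-∀

    slice-⊥ : k ≤ highest f → slice f k ⊥ ≡ + 0
    slice-⊥ k≤β rewrite f-⊥ = i≤j⇒i⊓j≡i (i≤j⇒0≤j-i k≤β)

    slice-rank : k ≤ highest f → IsRankFn (slice f k)
    slice-rank k≤β = slice-⊥ k≤β , slice-submodular

    InP⇒lowest≤ : ∀ {a} → InP f (a ∷ʳ k) → lowest f ≤ k
    InP⇒lowest≤ {a} a∈P = ≤-linear (InP⇒≤ a∈P (⊤ ∷ʳ false))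
      (trans (cong (λ r → k - (r - f (⊤ ∷ʳ false))) (trans (sym (proj₂ a∈P)) (total-∷ʳ a k)))
      (trans (shift k (total a) (f (⊤ ∷ʳ false)))
             (cong (_-_ (f (⊤ ∷ʳ false)))
               (sym (trans (subsetSum-∷ʳ a k ⊤ false) (cong (_+ + 0) (subsetSum-⊤ a)))))))
      where
      shift : ∀ k t q → k - (t + k - q) ≡ q - (t + + 0)
      shift = solve-∀

    InP⇒≤highest : ∀ {a} → InP f (a ∷ʳ k) → k ≤ highest f
    InP⇒≤highest {a} a∈P = subst (_≤ highest f)
      (trans (subsetSum-∷ʳ a k ⊥ true) (trans (cong (_+ k) (subsetSum-⊥ a)) (+-identityˡ k)))
      (InP⇒≤ a∈P (⊥ ∷ʳ true))

    InP⇒InP-slice : ∀ {a} → InP f (a ∷ʳ k) → InP (slice f k) a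
    InP⇒InP-slice {a} a∈P = ≤⇒InP
      (λ I → ⊓-glb
        (≤-linear (InP⇒≤ a∈P (I ∷ʳ false)) (trans (shift₀ (f (I ∷ʳ false)) (subsetSum a I))
           (cong (_-_ (f (I ∷ʳ false))) (sym (subsetSum-∷ʳ a k I false)))))
        (≤-linear (InP⇒≤ a∈P (I ∷ʳ true)) (trans (shift₁ (f (I ∷ʳ true)) (subsetSum a I) k)
           (cong (_-_ (f (I ∷ʳ true))) (sym (subsetSum-∷ʳ a k I true))))))
      (trans (shift (total a) k)
        (trans (cong (_- k) (trans (sym (total-∷ʳ a k)) (proj₂ a∈P)))
               (sym (slice-⊤ (InP⇒lowest≤ a∈P)))))
      where
      shift₀ : ∀ u s → u - s ≡ u - (s + + 0)
      shift₀ = solve-∀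
      shift₁ : ∀ u s k → u - k - s ≡ u - (s + k)
      shift₁ = solve-∀
      shift : ∀ t k → t ≡ t + k - k
      shift = solve-∀

    InP-slice⇒InP : lowest f ≤ k → ∀ {a} → InP (slice f k) a → InP f (a ∷ʳ k)
    InP-slice⇒InP α≤k {a} a∈P = ≤⇒InP ineq
      (trans (total-∷ʳ a k) (trans (cong (_+ k) (trans (proj₂ a∈P) (slice-⊤ α≤k))) (shift (f ⊤) k)))
      where
      shift : ∀ r k → r - k + k ≡ r
      shift = solve-∀
      shift₀ : ∀ u s → u - (s + + 0) ≡ u - s
      shift₀ = solve-∀
      shift₁ : ∀ u s k → u - (s + k) ≡ u - k - s
      shift₁ = solve-∀
      ineq : ∀ I → subsetSum (a ∷ʳ k) I ≤ f I
      ineq I with initLast I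
      ... | J , false , refl = ≤-linear (≤-trans (InP⇒≤ a∈P J) (slice≤₀ J))
        (trans (cong (_-_ (f (J ∷ʳ false))) (subsetSum-∷ʳ a k J false)) (shift₀ (f (J ∷ʳ false)) (subsetSum a J)))
      ... | J , true  , refl = ≤-linear (≤-trans (InP⇒≤ a∈P J) (slice≤₁ J))
        (trans (cong (_-_ (f (J ∷ʳ true))) (subsetSum-∷ʳ a k J true)) (shift₁ (f (J ∷ʳ true)) (subsetSum a J) k))

-- Activities of the indices below the last

shiftOut-inject₁ : ∀ {n} (a : Vec ℤ n) k i j →
  shiftOut (a ∷ʳ k) (inject₁ i) (inject₁ j) ≡ shiftOut a i j ∷ʳ k
shiftOut-inject₁ a k i j =
  trans (cong (λ v → updateAt v (inject₁ j) (_+ + 1)) (updateAt-inject₁ a k i (_- + 1)))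
        (updateAt-inject₁ (updateAt a i (_- + 1)) k j (_+ + 1))

shiftOut-fromℕ : ∀ {n} (a : Vec ℤ n) k j →
  shiftOut (a ∷ʳ k) (fromℕ n) (inject₁ j) ≡ updateAt a j (_+ + 1) ∷ʳ (k - + 1)
shiftOut-fromℕ a k j =
  trans (cong (λ v → updateAt v (inject₁ j) (_+ + 1)) (updateAt-fromℕ a k (_- + 1)))
        (updateAt-inject₁ a (k - + 1) j (_+ + 1))

tabulate-∷ʳ : {A : Set} {n : ℕ} (g : Fin (suc n) → A) →
  List.tabulate g ≡ List.tabulate (g ∘ inject₁) ++ g (fromℕ n) ∷ []
tabulate-∷ʳ {n = zero}  g = refl
tabulate-∷ʳ {n = suc n} g = cong (g zero ∷_) (tabulate-∷ʳ (g ∘ suc))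

allFin-∷ʳ : ∀ n → allFin (suc n) ≡ map inject₁ (allFin n) ++ fromℕ n ∷ []
allFin-∷ʳ n = trans (tabulate-∷ʳ (λ i → i))
  (cong (_++ fromℕ n ∷ []) (sym (List.map-tabulate (λ i → i) inject₁)))

filter-map : {A B : Set} {P : B → Set} {Q : A → Set} (P? : Decidable P) (Q? : Decidable Q) (h : A → B) →
  (∀ x → does (P? (h x)) ≡ does (Q? x)) → ∀ xs → filter P? (map h xs) ≡ map h (filter Q? xs)
filter-map P? Q? h eq []       = refl
filter-map P? Q? h eq (x ∷ xs) with does (P? (h x)) | does (Q? x) | eq x
... | true  | _ | refl = cong (h x ∷_) (filter-map P? Q? h eq xs)
... | false | _ | refl = filter-map P? Q? h eq xs

below-inject₁ : ∀ {n} (i : Fin n) → below (inject₁ i) ≡ map inject₁ (below i)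
below-inject₁ {n} i = begin
  filter P? (allFin (suc n))                                ≡⟨ cong (filter P?) (allFin-∷ʳ n) ⟩
  filter P? (map inject₁ (allFin n) ++ fromℕ n ∷ [])        ≡⟨ List.filter-++ P? (map inject₁ (allFin n)) _ ⟩
  filter P? (map inject₁ (allFin n)) ++ filter P? (fromℕ n ∷ [])
    ≡⟨ cong₂ _++_
         (filter-map P? (λ j → toℕ j ℕ.<? toℕ i) inject₁
           (λ j → cong₂ (λ u v → does (u ℕ.<? v)) (toℕ-inject₁ j) (toℕ-inject₁ i)) (allFin n))
         (List.filter-reject P? {x = fromℕ n} {xs = []} (λ n<i → ℕ.<-asym (inject₁ℕ< i)
           (subst (ℕ._< toℕ (inject₁ i)) (toℕ-fromℕ n) n<i))) ⟩
  map inject₁ (below i) ++ []                               ≡⟨ List.++-identityʳ _ ⟩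
  map inject₁ (below i) ∎
  where
  P? : Decidable (λ (j : Fin (suc n)) → toℕ j ℕ.< toℕ (inject₁ i))
  P? j = toℕ j ℕ.<? toℕ (inject₁ i)

below-fromℕ : ∀ n → below (fromℕ n) ≡ map inject₁ (allFin n)
below-fromℕ n = begin
  filter P? (allFin (suc n))                                ≡⟨ cong (filter P?) (allFin-∷ʳ n) ⟩
  filter P? (map inject₁ (allFin n) ++ fromℕ n ∷ [])        ≡⟨ List.filter-++ P? (map inject₁ (allFin n)) _ ⟩
  filter P? (map inject₁ (allFin n)) ++ filter P? (fromℕ n ∷ [])
    ≡⟨ cong₂ _++_
         (List.filter-all P? (All.tabulate λ {x} x∈ → inject₁< (∈-map⁻ inject₁ x∈)))
         (List.filter-reject P? {x = fromℕ n} {xs = []} (ℕ.<-irrefl refl)) ⟩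
  map inject₁ (allFin n) ++ []                              ≡⟨ List.++-identityʳ _ ⟩
  map inject₁ (allFin n) ∎
  where
  P? : Decidable (λ (j : Fin (suc n)) → toℕ j ℕ.< toℕ (fromℕ n))
  P? j = toℕ j ℕ.<? toℕ (fromℕ n)
  inject₁< : ∀ {x} → (∃ λ j → j ∈ allFin n × x ≡ inject₁ j) → toℕ x ℕ.< toℕ (fromℕ n)
  inject₁< (j , _ , refl) = subst (toℕ (inject₁ j) ℕ.<_) (sym (toℕ-fromℕ n)) (inject₁ℕ< j)

module _ {A : Set} where

  allB-cong : {p q : A → Bool} → (∀ x → p x ≡ q x) → ∀ xs → allB p xs ≡ allB q xs
  allB-cong eq []       = refl
  allB-cong eq (x ∷ xs) = cong₂ _∧_ (eq x) (allB-cong eq xs)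

  allB-map : {B : Set} (p : A → Bool) (h : B → A) (xs : List B) → allB p (map h xs) ≡ allB (p ∘ h) xs
  allB-map p h []       = refl
  allB-map p h (x ∷ xs) = cong (p (h x) ∧_) (allB-map p h xs)

  allB⇒ : (p : A → Bool) {x : A} {xs : List A} → allB p xs ≡ true → x ∈ xs → p x ≡ true
  allB⇒ p {xs = x ∷ xs} eq (here refl) with p x
  ... | true = refl
  allB⇒ p {xs = y ∷ xs} eq (there x∈) with p y
  ... | true = allB⇒ p eq x∈

  allB⇐ : (p : A → Bool) (xs : List A) → (∀ x → p x ≡ true) → allB p xs ≡ true
  allB⇐ p []       eq = refl
  allB⇐ p (x ∷ xs) eq rewrite eq x = allB⇐ p xs eq

inP-∷ʳ : ∀ {n} {f : SetFn (suc n)} → IsRankFn f → ∀ {k} → lowest f ≤ k → ∀ a →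
  inP f (a ∷ʳ k) ≡ inP (slice f k) a
inP-∷ʳ rank α≤k a = inP-cong (mk⇔ (InP⇒InP-slice rank) (InP-slice⇒InP rank α≤k))

intAct-inject₁ : ∀ {n} {f : SetFn (suc n)} → IsRankFn f → ∀ {k} → lowest f ≤ k → ∀ a i →
  intAct f (a ∷ʳ k) (inject₁ i) ≡ intAct (slice f k) a i
intAct-inject₁ {f = f} rank {k} α≤k a i =
  trans (cong (allB _) (below-inject₁ i))
  (trans (allB-map _ inject₁ (below i))
         (allB-cong (λ j → cong not (trans (cong (inP f) (shiftOut-inject₁ a k i j))
                                           (inP-∷ʳ rank α≤k (shiftOut a i j)))) (below i)))

-- Internal activity of the last index

≡true⇔⇒≡⌊⌋ : ∀ {b} {P : Set} → (b ≡ true ⇔ P) → (P? : Dec P) → b ≡ ⌊ P? ⌋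
≡true⇔⇒≡⌊⌋ eqv (yes p) = Equivalence.from eqv p
≡true⇔⇒≡⌊⌋ eqv (no ¬p) = Bool.¬-not (¬p ∘ Equivalence.to eqv)

not-⌊⌋⇒¬ : {P : Set} (P? : Dec P) → not ⌊ P? ⌋ ≡ true → ¬ P
not-⌊⌋⇒¬ (no ¬p) _ = ¬p

¬⇒not-⌊⌋ : {P : Set} (P? : Dec P) → ¬ P → not ⌊ P? ⌋ ≡ true
¬⇒not-⌊⌋ (yes p) ¬p = contradiction p ¬p
¬⇒not-⌊⌋ (no _)  ¬p = refl

module _ {n : ℕ} {f : SetFn (suc n)} (rank : IsRankFn f) {a : Vec ℤ n} {k : ℤ} (a∈P : InP f (a ∷ʳ k)) where

  Tight : Subset n → Set
  Tight J = subsetSum a J ≡ f (J ∷ʳ false)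

  subsetSum≤ : ∀ J → subsetSum a J ≤ f (J ∷ʳ false)
  subsetSum≤ J = subst (_≤ f (J ∷ʳ false))
    (trans (subsetSum-∷ʳ a k J false) (+-identityʳ _)) (InP⇒≤ a∈P (J ∷ʳ false))

  -- Uncrossing: by submodularity the tight sets are closed under union.
  Tight-∪ : ∀ I J → Tight I → Tight J → Tight (I ∪ J)
  Tight-∪ I J tI tJ = ≤-antisym (subsetSum≤ (I ∪ J))
    (≤-linear (+-mono-≤ (submodular-∷ʳ {f = f} rank I J false false) (subsetSum≤ (I ∩ J)))
      (trans (cong (_- f ((I ∪ J) ∷ʳ false)) (trans (add-sub (subsetSum a (I ∪ J)) (subsetSum a (I ∩ J)))
               (cong (_- subsetSum a (I ∩ J)) (trans (subsetSum-modular a I J) (cong₂ _+_ tI tJ)))))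
        (shift (f (I ∷ʳ false)) (f (J ∷ʳ false)) (subsetSum a (I ∩ J))
               (f ((I ∪ J) ∷ʳ false)) (f ((I ∩ J) ∷ʳ false)))))
    where
    add-sub : ∀ u v → u ≡ u + v - v
    add-sub = solve-∀
    shift : ∀ x y s u v → x + y - s - u ≡ x + y + v - (u + v + s)
    shift = solve-∀

  total-decrement : ∀ j → total (updateAt a j (_+ + 1) ∷ʳ (k - + 1)) ≡ f ⊤
  total-decrement j = trans (total-∷ʳ (updateAt a j (_+ + 1)) (k - + 1))
    (trans (cong (_+ (k - + 1)) (total-increment a j))
    (trans (shift (total a) k) (trans (sym (total-∷ʳ a k)) (proj₂ a∈P))))
    where
    shift : ∀ t k → t + + 1 + (k - + 1) ≡ t + k
    shift = solve-∀

  -- Moving one unit from the last coordinate to `j` increases the sum over a set only if the set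
  -- contains `j` but not the last index, and then by exactly 1. By integrality, an inequality
  -- violated after the move was an equality before it.
  ∉P⇒tight : ∀ j → ¬ InP f (updateAt a j (_+ + 1) ∷ʳ (k - + 1)) → ∃ λ J → lookup J j ≡ true × Tight J
  ∉P⇒tight j ∉P with ¬InP⇒violated (total-decrement j) ∉P
  ... | I , f< with initLast I
  ...   | J , b , refl = J , violated b (lookup J j) refl (subst (f (J ∷ʳ b) <_)
            (trans (subsetSum-∷ʳ (updateAt a j (_+ + 1)) (k - + 1) J b)
                   (cong (_+ (if b then k - + 1 else + 0)) (subsetSum-increment a j J))) f<)
    where
    violated : ∀ b c → lookup J j ≡ c →
      f (J ∷ʳ b) < subsetSum a J + (if lookup J j then + 1 else + 0) + (if b then k - + 1 else + 0) →
      lookup J j ≡ true × Tight J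
    violated b c eq lt rewrite eq with b | c
    ... | false | true  = refl , ≤-antisym (subsetSum≤ J)
            (≤-linear (i<j⇒suc[i]≤j lt) (shift (subsetSum a J) (f (J ∷ʳ false))))
      where
      shift : ∀ s u → s - u ≡ s + + 1 + + 0 - (+ 1 + u)
      shift = solve-∀
    ... | false | false = contradiction lt (≤⇒≯ (≤-trans (≤-reflexive (shift (subsetSum a J))) (subsetSum≤ J)))
      where
      shift : ∀ s → s + + 0 + + 0 ≡ s
      shift = solve-∀
    ... | true  | true  = contradiction lt (≤⇒≯ (subst (_≤ f (J ∷ʳ true))
            (trans (subsetSum-∷ʳ a k J true) (shift (subsetSum a J) k)) (InP⇒≤ a∈P (J ∷ʳ true))))
      where
      shift : ∀ s k → s + k ≡ s + + 1 + (k - + 1)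
      shift = solve-∀
    ... | true  | false = contradiction lt (≤⇒≯ (≤-linear (+-mono-≤ (InP⇒≤ a∈P (J ∷ʳ true)) (+≤+ (ℕ.z≤n {1})))
            (trans (shift (subsetSum a J) k (f (J ∷ʳ true)))
                   (cong (λ s → f (J ∷ʳ true) + + 1 - (s + + 0)) (sym (subsetSum-∷ʳ a k J true))))))
      where
      shift : ∀ s k u → u - (s + + 0 + (k - + 1)) ≡ u + + 1 - (s + k + + 0)
      shift = solve-∀

  -- The union starts from `⊥`, which is tight because `f` vanishes there. Applied to all of
  -- `allFin n`, it shows that the set of all indices but the last is tight, and this determines the
  -- last coordinate.
  tight-cover : (∀ j → ∃ λ J → lookup J j ≡ true × Tight J) →
    ∀ js → ∃ λ J → (∀ {j} → j ∈ js → lookup J j ≡ true) × Tight J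
  tight-cover tight []       = ⊥ , (λ ()) , trans (subsetSum-⊥ a) (sym (f-⊥ {f = f} rank))
  tight-cover tight (j ∷ js) with tight j | tight-cover tight js
  ... | I , j∈I , tI | J , js⊆J , tJ = I ∪ J , covers , Tight-∪ I J tI tJ
    where
    covers : ∀ {i} → i ∈ j ∷ js → lookup (I ∪ J) i ≡ true
    covers (here refl) = trans (lookup-zipWith _∨_ j I J) (cong (_∨ lookup J j) j∈I)
    covers {i} (there i∈) = trans (lookup-zipWith _∨_ i I J)
      (trans (cong (lookup I i ∨_) (js⊆J i∈)) (Bool.∨-zeroʳ (lookup I i)))

  Tight-⊤⇒lowest : Tight ⊤ → k ≡ lowest f
  Tight-⊤⇒lowest t = trans (shift (total a) k)
    (cong₂ _-_ (trans (sym (total-∷ʳ a k)) (proj₂ a∈P)) (trans (sym (subsetSum-⊤ a)) t))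
    where
    shift : ∀ t k → k ≡ t + k - t
    shift = solve-∀

  intAct-fromℕ : intAct f (a ∷ʳ k) (fromℕ n) ≡ ⌊ k ≟ lowest f ⌋
  intAct-fromℕ = ≡true⇔⇒≡⌊⌋ (mk⇔ to from) (k ≟ lowest f)
    where
    blocked : Fin (suc n) → Bool
    blocked j = not (inP f (shiftOut (a ∷ʳ k) (fromℕ n) j))
    intAct≡ : intAct f (a ∷ʳ k) (fromℕ n) ≡ allB (blocked ∘ inject₁) (allFin n)
    intAct≡ = trans (cong (allB blocked) (below-fromℕ n)) (allB-map blocked inject₁ (allFin n))
    blocked≡ : ∀ j → blocked (inject₁ j) ≡ not (inP f (updateAt a j (_+ + 1) ∷ʳ (k - + 1)))
    blocked≡ j = cong (not ∘ inP f) (shiftOut-fromℕ a k j)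
    to : intAct f (a ∷ʳ k) (fromℕ n) ≡ true → k ≡ lowest f
    to act with tight-cover
      (λ j → ∉P⇒tight j (not-⌊⌋⇒¬ (InP? f (updateAt a j (_+ + 1) ∷ʳ (k - + 1)))
        (trans (sym (blocked≡ j)) (allB⇒ (blocked ∘ inject₁) (trans (sym intAct≡) act) (∈-allFin j)))))
      (allFin n)
    ... | J , covers , tJ = Tight-⊤⇒lowest
      (subst Tight (lookup-true⇒⊤ J (λ j → covers (∈-allFin j))) tJ)
    from : k ≡ lowest f → intAct f (a ∷ʳ k) (fromℕ n) ≡ true
    -- Every move out of the last index ends on level `lowest f - 1`, where `P` has no points.
    from k≡α = trans intAct≡ (allB⇐ (blocked ∘ inject₁) (allFin n) λ j → trans (blocked≡ j)
      (¬⇒not-⌊⌋ (InP? f (updateAt a j (_+ + 1) ∷ʳ (k - + 1))) λ ∈P →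
        contradiction (subst (_≤ k - + 1) (sym k≡α) (InP⇒lowest≤ rank ∈P))
          (<⇒≱ (suc[i]≤j⇒i<j (≤-reflexive (shift k))))))
      where
      shift : ∀ k → + 1 + (k - + 1) ≡ k
      shift = solve-∀

-- Duality a ↦ -a

dual : ∀ {n} → SetFn n → SetFn n
dual f I = f (∁ I) - f ⊤

negate : ∀ {n} → Vec ℤ n → Vec ℤ n
negate a = Vec.map -_ a

module _ {n : ℕ} where
  open BooleanAlgebra (∪-∩-booleanAlgebra n) public
    using () renaming (deMorgan₁ to ∁-∩; deMorgan₂ to ∁-∪; ¬-involutive to ∁-∁)

∁-⊤ : ∀ n → ∁ (⊤ {n}) ≡ ⊥
∁-⊤ n = map-replicate not true n

∁-⊥ : ∀ n → ∁ (⊥ {n}) ≡ ⊤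
∁-⊥ n = map-replicate not false n

dual-⊤ : ∀ {n} {f : SetFn n} → IsRankFn f → dual f ⊤ ≡ - f ⊤
dual-⊤ {n} {f} rank = trans (cong (_- f ⊤) (trans (cong f (∁-⊤ n)) (proj₁ rank))) (+-identityˡ (- f ⊤))

dual-rank : ∀ {n} {f : SetFn n} → IsRankFn f → IsRankFn (dual f)
dual-rank {n} {f} rank = i≡j⇒i-j≡0 (cong f (∁-⊥ n)) , submodular
  where
  shift : ∀ p q u v r → p - r + (q - r) - (u - r + (v - r)) ≡ p + q - (v + u)
  shift = solve-∀
  submodular : ∀ I J → dual f (I ∪ J) + dual f (I ∩ J) ≤ dual f I + dual f J
  submodular I J rewrite ∁-∪ I J | ∁-∩ I J =
    ≤-linear (proj₂ rank (∁ I) (∁ J))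
      (shift (f (∁ I)) (f (∁ J)) (f (∁ I ∩ ∁ J)) (f (∁ I ∪ ∁ J)) (f ⊤))

-- Since the total of `a` is `f ⊤`, the sum of `negate a` over `I` equals the sum of `a` over `∁ I`
-- minus `f ⊤`. The inequality of `dual f` at `I` is thus the inequality of `f` at `∁ I`.
InP⇒InP-dual : ∀ {n} {f : SetFn n} → IsRankFn f → ∀ {a} → InP f a → InP (dual f) (negate a)
InP⇒InP-dual {f = f} rank {a} a∈P = ≤⇒InP
  (λ I → subst (_≤ dual f I) (sym (trans (subsetSum-∁ a I) (cong (_-_ (subsetSum a (∁ I))) (proj₂ a∈P))))
    (+-monoˡ-≤ (- f ⊤) (InP⇒≤ a∈P (∁ I))))
  (trans (total-neg a) (trans (cong -_ (proj₂ a∈P)) (sym (dual-⊤ {f = f} rank))))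

InP-dual⇒InP : ∀ {n} {f : SetFn n} → IsRankFn f → ∀ {a} → InP (dual f) (negate a) → InP f a
InP-dual⇒InP {f = f} rank {a} a∈P = ≤⇒InP
  (λ I → subst (λ J → subsetSum a J ≤ f J) (∁-∁ I)
    (+-cancelʳ-≤ (subsetSum a (∁ (∁ I))) (f (∁ (∁ I))) (- f ⊤)
      (subst (_≤ dual f (∁ I))
        (trans (subsetSum-∁ a (∁ I)) (cong (_-_ (subsetSum a (∁ (∁ I)))) total≡)) (InP⇒≤ a∈P (∁ I)))))
  total≡
  where
  +-cancelʳ-≤ : ∀ i j k → i + k ≤ j + k → i ≤ j
  +-cancelʳ-≤ i j k le = ≤-linear le (shift i j k)
    where
    shift : ∀ i j k → j - i ≡ j + k - (i + k)
    shift = solve-∀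
  total≡ : total a ≡ f ⊤
  total≡ = neg-injective (trans (sym (total-neg a)) (trans (proj₂ a∈P) (dual-⊤ {f = f} rank)))

inP-dual : ∀ {n} {f : SetFn n} → IsRankFn f → ∀ a → inP (dual f) (negate a) ≡ inP f a
inP-dual rank a = inP-cong (mk⇔ (InP-dual⇒InP rank) (InP⇒InP-dual rank))

neg-updateAt : ∀ {n} (a : Vec ℤ n) i (g h : ℤ → ℤ) → (∀ x → - g x ≡ h (- x)) →
  negate (updateAt a i g) ≡ updateAt (negate a) i h
neg-updateAt a i g h eq = map-updateAt a i (eq (lookup a i))

neg-pred : ∀ x → - (x - + 1) ≡ - x + + 1
neg-pred = solve-∀

neg-suc′ : ∀ x → - (x + + 1) ≡ - x - + 1
neg-suc′ = solve-∀

neg-shiftIn : ∀ {n} (a : Vec ℤ n) i j → negate (shiftIn a i j) ≡ shiftOut (negate a) i j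
neg-shiftIn a i j = trans
  (neg-updateAt (updateAt a i (_+ + 1)) j (_- + 1) (_+ + 1) neg-pred)
  (cong (λ v → updateAt v j (_+ + 1)) (neg-updateAt a i (_+ + 1) (_- + 1) neg-suc′))

neg-shiftOut : ∀ {n} (a : Vec ℤ n) i j → negate (shiftOut a i j) ≡ shiftIn (negate a) i j
neg-shiftOut a i j = trans
  (neg-updateAt (updateAt a i (_- + 1)) j (_+ + 1) (_- + 1) neg-suc′)
  (cong (λ v → updateAt v j (_- + 1)) (neg-updateAt a i (_- + 1) (_+ + 1) neg-pred))

-- Negation carries `shiftIn` to `shiftOut` and leaves the order of the indices alone, so the two
-- activities change places.
intAct-dual : ∀ {n} {f : SetFn n} → IsRankFn f → ∀ a i → intAct (dual f) (negate a) i ≡ extAct f a i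
intAct-dual {f = f} rank a i = allB-cong (λ j → cong not
  (trans (cong (inP (dual f)) (sym (neg-shiftIn a i j))) (inP-dual rank (shiftIn a i j)))) (below i)

extAct-dual : ∀ {n} {f : SetFn n} → IsRankFn f → ∀ a i → extAct (dual f) (negate a) i ≡ intAct f a i
extAct-dual {f = f} rank a i = allB-cong (λ j → cong not
  (trans (cong (inP (dual f)) (sym (neg-shiftOut a i j))) (inP-dual rank (shiftOut a i j)))) (below i)

⌊⌋-cong : {P Q : Set} → P ⇔ Q → (P? : Dec P) (Q? : Dec Q) → ⌊ P? ⌋ ≡ ⌊ Q? ⌋
⌊⌋-cong eqv P? Q? = trans (isYes≗does P?) (trans (does-⇔ eqv P? Q?) (sym (isYes≗does Q?)))

shiftIn-inject₁ : ∀ {n} (a : Vec ℤ n) k i j →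
  shiftIn (a ∷ʳ k) (inject₁ i) (inject₁ j) ≡ shiftIn a i j ∷ʳ k
shiftIn-inject₁ a k i j =
  trans (cong (λ v → updateAt v (inject₁ j) (_- + 1)) (updateAt-inject₁ a k i (_+ + 1)))
        (updateAt-inject₁ (updateAt a i (_+ + 1)) k j (_- + 1))

extAct-inject₁ : ∀ {n} {f : SetFn (suc n)} → IsRankFn f → ∀ {k} → lowest f ≤ k → ∀ a i →
  extAct f (a ∷ʳ k) (inject₁ i) ≡ extAct (slice f k) a i
extAct-inject₁ {f = f} rank {k} α≤k a i =
  trans (cong (allB _) (below-inject₁ i))
  (trans (allB-map _ inject₁ (below i))
         (allB-cong (λ j → cong not (trans (cong (inP f) (shiftIn-inject₁ a k i j))
                                           (inP-∷ʳ rank α≤k (shiftIn a i j)))) (below i)))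

lowest-dual : ∀ {n} {f : SetFn (suc n)} → IsRankFn f → lowest (dual f) ≡ - highest f
lowest-dual {n} {f} rank = trans (cong₂ _-_ (dual-⊤ {f = f} rank) (cong (λ I → f I - f ⊤) ∁≡))
  (shift (f ⊤) (highest f))
  where
  ∁≡ : ∁ (⊤ ∷ʳ false) ≡ ⊥ ∷ʳ true
  ∁≡ = trans (map-∷ʳ not false (⊤ {n})) (cong (_∷ʳ true) (∁-⊤ n))
  shift : ∀ r b → - r - (b - r) ≡ - b
  shift = solve-∀

extAct-fromℕ : ∀ {n} {f : SetFn (suc n)} → IsRankFn f → ∀ {a k} → InP f (a ∷ʳ k) →
  extAct f (a ∷ʳ k) (fromℕ n) ≡ ⌊ k ≟ highest f ⌋
extAct-fromℕ {n} {f} rank {a} {k} a∈P = begin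
  extAct f (a ∷ʳ k) (fromℕ n)
    ≡⟨ intAct-dual rank (a ∷ʳ k) (fromℕ n) ⟨
  intAct (dual f) (negate (a ∷ʳ k)) (fromℕ n)
    ≡⟨ cong (λ v → intAct (dual f) v (fromℕ n)) neg-∷ʳ ⟩
  intAct (dual f) (negate a ∷ʳ - k) (fromℕ n)
    ≡⟨ intAct-fromℕ (dual-rank {f = f} rank) (subst (InP (dual f)) neg-∷ʳ (InP⇒InP-dual rank a∈P)) ⟩
  ⌊ - k ≟ lowest (dual f) ⌋
    ≡⟨ ⌊⌋-cong (mk⇔ (λ eq → neg-injective (trans eq (lowest-dual {f = f} rank)))
                    (λ eq → trans (cong (λ i → - i) eq) (sym (lowest-dual {f = f} rank)))) _ _ ⟩
  ⌊ k ≟ highest f ⌋ ∎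
  where
  neg-∷ʳ : negate (a ∷ʳ k) ≡ negate a ∷ʳ - k
  neg-∷ʳ = map-∷ʳ (λ i → - i) k a

-- Peeling off the last index

count : {A : Set} → (A → Bool) → List A → ℕ
count p xs = length (filter (λ x → p x Bool.≟ true) xs)

count-cong : {A : Set} {p q : A → Bool} → (∀ x → p x ≡ q x) → ∀ xs → count p xs ≡ count q xs
count-cong eq []       = refl
count-cong {p = p} {q} eq (x ∷ xs) with p x | q x | eq x
... | true  | _ | refl = cong suc (count-cong eq xs)
... | false | _ | refl = count-cong eq xs

countB-cong : ∀ {n} {p q : Fin n → Bool} → (∀ x → p x ≡ q x) → countB p ≡ countB q
countB-cong eq = count-cong eq (allFin _)

-- The contribution of the last index stands in front so that, once its activities are known, it
-- reduces to a visible successor in an exponent; this is the form on which `coeffX-peel` computes.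
countB-∷ʳ : ∀ {n} (p : Fin (suc n) → Bool) →
  countB p ≡ (if p (fromℕ n) then 1 else 0) ℕ.+ countB (p ∘ inject₁)
countB-∷ʳ {n} p = begin
  count p (allFin (suc n))                                  ≡⟨ cong (count p) (allFin-∷ʳ n) ⟩
  count p (map inject₁ (allFin n) ++ fromℕ n ∷ [])
    ≡⟨ cong length (List.filter-++ p? (map inject₁ (allFin n)) (fromℕ n ∷ [])) ⟩
  length (filter p? (map inject₁ (allFin n)) ++ filter p? (fromℕ n ∷ []))
    ≡⟨ List.length-++ (filter p? (map inject₁ (allFin n))) ⟩
  count p (map inject₁ (allFin n)) ℕ.+ count p (fromℕ n ∷ [])
    ≡⟨ cong₂ ℕ._+_ (trans
         (cong length (filter-map p? (λ i → p (inject₁ i) Bool.≟ true) inject₁ (λ _ → refl) (allFin n)))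
         (List.length-map inject₁ (filter (λ i → p (inject₁ i) Bool.≟ true) (allFin n)))) singleton ⟩
  countB (p ∘ inject₁) ℕ.+ (if p (fromℕ n) then 1 else 0)   ≡⟨ ℕ.+-comm (countB (p ∘ inject₁)) _ ⟩
  (if p (fromℕ n) then 1 else 0) ℕ.+ countB (p ∘ inject₁) ∎
  where
  p? : Decidable (λ i → p i ≡ true)
  p? i = p i Bool.≟ true
  singleton : count p (fromℕ n ∷ []) ≡ (if p (fromℕ n) then 1 else 0)
  singleton with p (fromℕ n)
  ... | true  = refl
  ... | false = refl

-- The effect, on coefficients at y⁰, of the factor contributed by one index with given activities.
peel : Bool → Bool → (ℤ → ℤ) → ℤ → ℤ
peel true  true  t z = t (z - + 1) - t z
peel true  false t z = t (z - + 1)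
peel false true  t z = + 0
peel false false t z = t z

coeffX-peel : ∀ i e p q b z →
  coeffX z (term ((if i ∧ not e then 1 else 0) ℕ.+ p) ((if e ∧ not i then 1 else 0) ℕ.+ q)
                 ((if i ∧ e then 1 else 0) ℕ.+ b))
  ≡ peel i e (λ z → coeffX z (term p q b)) z
coeffX-peel true  true  p q b z = coeffX-term-XY1 z p q b
coeffX-peel true  false p q b z = coeffX-term-X z p q b
coeffX-peel false true  p q b z = coeffX-term-Y z p q b
coeffX-peel false false p q b z = refl

cong₃ : ∀ {A B C D : Set} (h : A → B → C → D) {x x′ y y′ z z′} →
  x ≡ x′ → y ≡ y′ → z ≡ z′ → h x y z ≡ h x′ y′ z′
cong₃ h refl refl refl = refl

coeffX-tutteTerm-∷ʳ : ∀ {n} {f : SetFn (suc n)} → IsRankFn f → ∀ {a k} → InP f (a ∷ʳ k) → ∀ z →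
  coeffX z (tutteTerm f (a ∷ʳ k))
  ≡ peel ⌊ k ≟ lowest f ⌋ ⌊ k ≟ highest f ⌋ (λ z → coeffX z (tutteTerm (slice f k) a)) z
coeffX-tutteTerm-∷ʳ {n} {f} rank {a} {k} a∈P z =
  trans (cong (coeffX z) (cong₃ term (counts (λ i e → i ∧ not e)) (counts (λ i e → e ∧ not i)) (counts _∧_)))
        (coeffX-peel ⌊ k ≟ lowest f ⌋ ⌊ k ≟ highest f ⌋ _ _ _ z)
  where
  α≤k = InP⇒lowest≤ rank a∈P
  counts : (g : Bool → Bool → Bool) →
    countB (λ i → g (intAct f (a ∷ʳ k) i) (extAct f (a ∷ʳ k) i))
    ≡ (if g ⌊ k ≟ lowest f ⌋ ⌊ k ≟ highest f ⌋ then 1 else 0)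
      ℕ.+ countB (λ i → g (intAct (slice f k) a i) (extAct (slice f k) a i))
  counts g = trans (countB-∷ʳ (λ i → g (intAct f (a ∷ʳ k) i) (extAct f (a ∷ʳ k) i)))
    (cong₂ (λ b c → (if b then 1 else 0) ℕ.+ c)
      (cong₂ g (intAct-fromℕ rank a∈P) (extAct-fromℕ rank a∈P))
      (countB-cong (λ i → cong₂ g (intAct-inject₁ rank α≤k a i) (extAct-inject₁ rank α≤k a i))))

sumBy-peel : {A : Set} (i e : Bool) (t : A → ℤ → ℤ) (z : ℤ) (xs : List A) →
  sumBy (λ x → peel i e (t x) z) xs ≡ peel i e (λ z → sumBy (λ x → t x z) xs) z
sumBy-peel true  true  t z xs = trans (sumBy-+ (λ x → t x (z - + 1)) (λ x → - t x z) xs)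
  (cong (_+_ (sumBy (λ x → t x (z - + 1)) xs)) (sumBy-neg (λ x → t x z) xs))
sumBy-peel true  false t z xs = refl
sumBy-peel false true  t z xs = sumBy-0 xs
sumBy-peel false false t z xs = refl

-- Enumerations of the slices

slicePoints : ∀ {n} → ℤ → List (Vec ℤ (suc n)) → List (Vec ℤ n)
slicePoints k L = map Vec.init (filter (λ v → Vec.last v ≟ k) L)

init-last : ∀ {n} (v : Vec ℤ (suc n)) → v ≡ Vec.init v ∷ʳ Vec.last v
init-last v = proj₂ (proj₂ (initLast v))

init-last-injective : ∀ {n} {u v : Vec ℤ (suc n)} → Vec.init u ≡ Vec.init v → Vec.last u ≡ Vec.last v → u ≡ v
init-last-injective {u = u} {v} p q = trans (init-last u) (trans (cong₂ _∷ʳ_ p q) (sym (init-last v)))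

slicePoints-Unique : ∀ {n} k (L : List (Vec ℤ (suc n))) → Unique L → Unique (slicePoints k L)
slicePoints-Unique k []      []        = []
slicePoints-Unique k (v ∷ L) (v∉L ∷ u) with Vec.last v ≟ k
... | no  _    = slicePoints-Unique k L u
... | yes refl = map⁺ (All.tabulate λ {w} w∈ → distinct (∈-filter⁻ (λ v → Vec.last v ≟ k) w∈))
                 ∷ slicePoints-Unique k L u
  where
  distinct : ∀ {w} → w ∈ L × Vec.last w ≡ k → Vec.init v ≢ Vec.init w
  distinct (w∈L , eq) eq′ = All.lookup v∉L w∈L (init-last-injective eq′ (sym eq))

∈-slicePoints⇒ : ∀ {n} k (L : List (Vec ℤ (suc n))) {a} → a ∈ slicePoints k L → a ∷ʳ k ∈ L
∈-slicePoints⇒ k L a∈ with ∈-map⁻ Vec.init a∈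
... | v , v∈ , refl with ∈-filter⁻ (λ v → Vec.last v ≟ k) v∈
...   | v∈L , refl = subst (_∈ L) (init-last v) v∈L

∈-slicePoints⇐ : ∀ {n} k (L : List (Vec ℤ (suc n))) {a} → a ∷ʳ k ∈ L → a ∈ slicePoints k L
∈-slicePoints⇐ k L {a} a∈ = subst (_∈ slicePoints k L) (init-∷ʳ k a)
  (∈-map⁺ Vec.init (∈-filter⁺ (λ v → Vec.last v ≟ k) a∈ (last-∷ʳ k a)))

slicePoints-Enumerates : ∀ {n} {f : SetFn (suc n)} → IsRankFn f → ∀ {L} → Enumerates f L →
  ∀ {k} → lowest f ≤ k → Enumerates (slice f k) (slicePoints k L)
slicePoints-Enumerates rank {L} (unique , iff) {k} α≤k =
  slicePoints-Unique k L unique , λ a → mk⇔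
    (λ a∈ → InP⇒InP-slice rank (Equivalence.to (iff (a ∷ʳ k)) (∈-slicePoints⇒ k L a∈)))
    (λ a∈P → ∈-slicePoints⇐ k L (Equivalence.from (iff (a ∷ʳ k)) (InP-slice⇒InP rank α≤k a∈P)))

-- Sums over the levels

sumUpTo : (ℕ → ℤ) → ℕ → ℤ
sumUpTo g zero    = + 0
sumUpTo g (suc N) = sumUpTo g N + g N

sumUpTo-cong : ∀ {g h : ℕ → ℤ} N → (∀ {j} → j ℕ.< N → g j ≡ h j) → sumUpTo g N ≡ sumUpTo h N
sumUpTo-cong zero    eq = refl
sumUpTo-cong (suc N) eq = cong₂ _+_ (sumUpTo-cong N (eq ∘ ℕ.m<n⇒m<1+n)) (eq (ℕ.n<1+n N))

sumUpTo-+ : ∀ (g h : ℕ → ℤ) N → sumUpTo (λ j → g j + h j) N ≡ sumUpTo g N + sumUpTo h N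
sumUpTo-+ g h zero    = refl
sumUpTo-+ g h (suc N) = trans (cong (_+ (g N + h N)) (sumUpTo-+ g h N))
  (interchange (sumUpTo g N) (sumUpTo h N) (g N) (h N))

sumUpTo-0 : ∀ N → sumUpTo (λ _ → + 0) N ≡ + 0
sumUpTo-0 zero    = refl
sumUpTo-0 (suc N) = cong (_+ + 0) (sumUpTo-0 N)

≡⇒⌊⌋ : {P : Set} (P? : Dec P) → P → ⌊ P? ⌋ ≡ true
≡⇒⌊⌋ (yes _) p = refl
≡⇒⌊⌋ (no ¬p) p = contradiction p ¬p

¬⇒⌊⌋ : {P : Set} (P? : Dec P) → ¬ P → ⌊ P? ⌋ ≡ false
¬⇒⌊⌋ (yes p) ¬p = contradiction p ¬p
¬⇒⌊⌋ (no _)  ¬p = refl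

sumUpTo-δ : ∀ x {j₀} N → j₀ ℕ.< N → sumUpTo (λ j → if ⌊ j₀ ℕ.≟ j ⌋ then x else + 0) N ≡ x
sumUpTo-δ x {j₀} (suc N) j₀<1+N with j₀ ℕ.≟ N
... | yes refl = trans (cong (_+ x) (trans (sumUpTo-cong N (λ {j} j<N →
                   cong (if_then x else + 0) (¬⇒⌊⌋ (j₀ ℕ.≟ j) (λ { refl → ℕ.<-irrefl refl j<N }))))
                   (sumUpTo-0 N))) (+-identityˡ x)
... | no j₀≢N  = trans (+-identityʳ _) (sumUpTo-δ x N (ℕ.≤∧≢⇒< (ℕ.s≤s⁻¹ j₀<1+N) j₀≢N))

level⇔ : ∀ {k β} → k ≤ β → ∀ j → k ≡ β - + j ⇔ ∣ β - k ∣ ≡ j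
level⇔ {k} {β} k≤β j = mk⇔
  (λ eq → +-injective (trans distance (trans (cong (_-_ β) eq) (cancel β (+ j)))))
  (λ eq → trans (sym (cancel β k)) (cong (_-_ β) (trans (sym distance) (cong +_ eq))))
  where
  distance : + ∣ β - k ∣ ≡ β - k
  distance = 0≤i⇒+∣i∣≡i (i≤j⇒0≤j-i k≤β)
  cancel : ∀ b c → b - (b - c) ≡ c
  cancel = solve-∀

-- Levels are numbered downwards from `β` by natural numbers. The bound puts every point of `L` on
-- one of the levels `0, ..., m`; it is counted on that level and on no other, which is what
-- `sumUpTo-δ` evaluates.
sumBy-slicePoints : ∀ {n} (g : Vec ℤ (suc n) → ℤ) β m L →
  (∀ {v} → v ∈ L → Vec.last v ≤ β × ∣ β - Vec.last v ∣ ℕ.≤ m) →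
  sumBy g L ≡ sumUpTo (λ j → sumBy (λ a → g (a ∷ʳ (β - + j))) (slicePoints (β - + j) L)) (suc m)
sumBy-slicePoints g β m []      bound = sym (sumUpTo-0 (suc m))
sumBy-slicePoints g β m (v ∷ L) bound = sym (begin
  sumUpTo (λ j → S j (v ∷ L)) (suc m)                             ≡⟨ sumUpTo-cong (suc m) (λ {j} _ → split j) ⟩
  sumUpTo (λ j → (if ⌊ ∣ β - Vec.last v ∣ ℕ.≟ j ⌋ then g v else + 0) + S j L) (suc m)
    ≡⟨ sumUpTo-+ (λ j → if ⌊ ∣ β - Vec.last v ∣ ℕ.≟ j ⌋ then g v else + 0) (λ j → S j L) (suc m) ⟩
  sumUpTo (λ j → if ⌊ ∣ β - Vec.last v ∣ ℕ.≟ j ⌋ then g v else + 0) (suc m) + sumUpTo (λ j → S j L) (suc m)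
    ≡⟨ cong₂ _+_ (sumUpTo-δ (g v) (suc m) (ℕ.s≤s (proj₂ (bound (here refl)))))
                 (sym (sumBy-slicePoints g β m L (bound ∘ there))) ⟩
  g v + sumBy g L ∎)
  where
  S : ℕ → List _ → ℤ
  S j L = sumBy (λ a → g (a ∷ʳ (β - + j))) (slicePoints (β - + j) L)
  split : ∀ j → S j (v ∷ L) ≡ (if ⌊ ∣ β - Vec.last v ∣ ℕ.≟ j ⌋ then g v else + 0) + S j L
  split j = trans split′ (cong (λ b → (if b then g v else + 0) + S j L)
    (⌊⌋-cong (level⇔ (proj₁ (bound (here refl))) j) (Vec.last v ≟ β - + j) (∣ β - Vec.last v ∣ ℕ.≟ j)))
    where
    split′ : S j (v ∷ L) ≡ (if ⌊ Vec.last v ≟ β - + j ⌋ then g v else + 0) + S j L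
    split′ with Vec.last v ≟ β - + j
    ... | yes eq = cong (λ w → g w + S j L) (sym (trans (init-last v) (cong (Vec.init v ∷ʳ_) eq)))
    ... | no  _  = sym (+-identityˡ (S j L))

-- Level `m` is the lowest and level 0 the highest. If `m` is positive, the highest slice carries
-- the factor `y` and contributes nothing at `y = 0`; subtracting `t 0 z` removes it from the sum.
-- If `m` is 0, the single slice carries `x + y - 1`, and the same subtraction is its `-1`. One
-- formula therefore covers both cases.
sumUpTo-peel : ∀ (t : ℕ → ℤ → ℤ) z m →
  sumUpTo (λ j → peel ⌊ m ℕ.≟ j ⌋ ⌊ 0 ℕ.≟ j ⌋ (t j) z) (suc m)
  ≡ t m (z - + 1) + sumUpTo (λ j → t j z) m - t 0 z
sumUpTo-peel t z zero    = shift (t 0 (z - + 1)) (t 0 z)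
  where
  shift : ∀ x y → + 0 + (x - y) ≡ x + + 0 - y
  shift = solve-∀
sumUpTo-peel t z (suc m) = trans
  (cong₂ _+_ (trans (sumUpTo-cong (suc m) (λ {j} j≤m →
                cong (λ b → peel b ⌊ 0 ℕ.≟ j ⌋ (t j) z)
                  (¬⇒⌊⌋ (suc m ℕ.≟ j) (λ { refl → ℕ.<-irrefl refl j≤m }))))
              (inner m))
             (cong (λ b → peel b false (t (suc m)) z) (≡⇒⌊⌋ (suc m ℕ.≟ suc m) refl)))
  (shift (sumUpTo (λ j → t j z) (suc m)) (t 0 z) (t (suc m) (z - + 1)))
  where
  shift : ∀ s y x → s - y + x ≡ x + s - y
  shift = solve-∀
  inner : ∀ m → sumUpTo (λ j → peel false ⌊ 0 ℕ.≟ j ⌋ (t j) z) (suc m)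
              ≡ sumUpTo (λ j → t j z) (suc m) - t 0 z
  inner zero    = shift′ (t 0 z)
    where
    shift′ : ∀ x → + 0 ≡ + 0 + x - x
    shift′ = solve-∀
  inner (suc m) = trans (cong (_+ t (suc m) z) (inner m)) (shift′ (sumUpTo (λ j → t j z) (suc m)) (t 0 z) (t (suc m) z))
    where
    shift′ : ∀ s y x → s - y + x ≡ s + x - y
    shift′ = solve-∀

-- The recursion over the slices

width : ∀ {n} → SetFn (suc n) → ℕ
width f = ∣ highest f - lowest f ∣

level : ∀ {n} → SetFn (suc n) → ℕ → ℤ
level f j = highest f - + j

sliceAt : ∀ {n} → SetFn (suc n) → ℕ → SetFn n
sliceAt f j = slice f (level f j)

module _ {n : ℕ} {f : SetFn (suc n)} (rank : IsRankFn f) where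

  -- Subadditivity of `f` on the disjoint sets consisting of the last index and of all the others.
  lowest≤highest : lowest f ≤ highest f
  lowest≤highest = ≤-linear (submodular-∷ʳ {f = f} rank ⊤ ⊥ false true)
    (trans (shift (f ⊤) (f (⊤ ∷ʳ false)) (f (⊥ ∷ʳ true)))
      (cong₂ (λ x y → f (⊤ ∷ʳ false) + f (⊥ ∷ʳ true) - (x + y))
        (sym (trans (cong (λ I → f (I ∷ʳ true)) (BA.∨-identityʳ ⊤)) (f-⊤ {f = f} rank)))
        (sym (trans (cong (λ I → f (I ∷ʳ false)) (BA.∧-identityˡ ⊥)) (f-⊥ {f = f} rank)))))
    where
    module BA = BooleanAlgebra (∪-∩-booleanAlgebra n)
    shift : ∀ r q b → b - (r - q) ≡ q + b - (r + + 0)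
    shift = solve-∀

  width≡ : + width f ≡ highest f - lowest f
  width≡ = 0≤i⇒+∣i∣≡i (i≤j⇒0≤j-i lowest≤highest)

  lowest≤level : ∀ {j} → j ℕ.≤ width f → lowest f ≤ level f j
  lowest≤level {j} j≤m = ≤-linear (+≤+ j≤m)
    (trans (shift (highest f) (+ j) (lowest f)) (cong (_- + j) (sym width≡)))
    where
    shift : ∀ b j a → b - j - a ≡ b - a - j
    shift = solve-∀

  level≤highest : ∀ j → level f j ≤ highest f
  level≤highest j = ≤-linear (+≤+ (ℕ.z≤n {j})) (shift (highest f) (+ j))
    where
    shift : ∀ b j → b - (b - j) ≡ j - + 0
    shift = solve-∀

  sliceAt-rank : ∀ j → IsRankFn (sliceAt f j)
  sliceAt-rank j = slice-rank {f = f} rank (level≤highest j)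

  module _ {L : List (Vec ℤ (suc n))} (enum : Enumerates f L) where

    sliceAt-Enumerates : ∀ {j} → j ℕ.≤ width f → Enumerates (sliceAt f j) (slicePoints (level f j) L)
    sliceAt-Enumerates j≤m = slicePoints-Enumerates rank enum (lowest≤level j≤m)

    coeffX-tutte-slices : ∀ z → coeffX z (tutte f L) ≡
        coeffX (z - + 1) (tutte (sliceAt f (width f)) (slicePoints (level f (width f)) L))
      + sumUpTo (λ j → coeffX z (tutte (sliceAt f j) (slicePoints (level f j) L))) (width f)
      - coeffX z (tutte (sliceAt f 0) (slicePoints (level f 0) L))
    coeffX-tutte-slices z = begin
      coeffX z (tutte f L)
        ≡⟨ coeffX-tutte z f L ⟩
      sumBy (coeffX z ∘ tutteTerm f) L
        ≡⟨ sumBy-slicePoints (coeffX z ∘ tutteTerm f) (highest f) (width f) L bound ⟩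
      sumUpTo (λ j → sumBy (λ a → coeffX z (tutteTerm f (a ∷ʳ level f j))) (slicePoints (level f j) L)) (suc (width f))
        ≡⟨ sumUpTo-cong (suc (width f)) (λ {j} j<1+m → sliceSum j (ℕ.s≤s⁻¹ j<1+m)) ⟩
      sumUpTo (λ j → peel ⌊ width f ℕ.≟ j ⌋ ⌊ 0 ℕ.≟ j ⌋
        (λ z → coeffX z (tutte (sliceAt f j) (slicePoints (level f j) L))) z) (suc (width f))
        ≡⟨ sumUpTo-peel (λ j z → coeffX z (tutte (sliceAt f j) (slicePoints (level f j) L))) z (width f) ⟩
      _ ∎
      where
      bound : ∀ {v} → v ∈ L → Vec.last v ≤ highest f × ∣ highest f - Vec.last v ∣ ℕ.≤ width f
      bound {v} v∈L = k≤β , drop‿+≤+ (subst₂ _≤_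
          (sym (0≤i⇒+∣i∣≡i (i≤j⇒0≤j-i k≤β))) (sym width≡)
          (+-monoʳ-≤ (highest f) (neg-mono-≤ (InP⇒lowest≤ rank v∈P))))
        where
        v∈P : InP f (Vec.init v ∷ʳ Vec.last v)
        v∈P = subst (InP f) (init-last v) (Equivalence.to (proj₂ enum v) v∈L)
        k≤β = InP⇒≤highest rank v∈P
      flag : ∀ j {c} (c≤β : c ≤ highest f) → ⌊ level f j ≟ c ⌋ ≡ ⌊ ∣ highest f - c ∣ ℕ.≟ j ⌋
      flag j {c} c≤β = ⌊⌋-cong (mk⇔ (Equivalence.to (level⇔ c≤β j) ∘ sym)
                                    (sym ∘ Equivalence.from (level⇔ c≤β j))) _ _
      sliceSum : ∀ j → j ℕ.≤ width f →
        sumBy (λ a → coeffX z (tutteTerm f (a ∷ʳ level f j))) (slicePoints (level f j) L)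
        ≡ peel ⌊ width f ℕ.≟ j ⌋ ⌊ 0 ℕ.≟ j ⌋ (λ z → coeffX z (tutte (sliceAt f j) (slicePoints (level f j) L))) z
      sliceSum j j≤m = begin
        sumBy (λ a → coeffX z (tutteTerm f (a ∷ʳ level f j))) Lⱼ
          ≡⟨ sumBy-cong∈ Lⱼ (λ {a} a∈ → coeffX-tutteTerm-∷ʳ rank
               (Equivalence.to (proj₂ enum (a ∷ʳ level f j)) (∈-slicePoints⇒ (level f j) L a∈)) z) ⟩
        sumBy (λ a → peel i e (λ z → coeffX z (tutteTerm (sliceAt f j) a)) z) Lⱼ
          ≡⟨ sumBy-peel i e (λ a z → coeffX z (tutteTerm (sliceAt f j) a)) z Lⱼ ⟩
        peel i e (λ z → sumBy (coeffX z ∘ tutteTerm (sliceAt f j)) Lⱼ) z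
          ≡⟨ peel-cong i e (λ z → coeffX-tutte z (sliceAt f j) Lⱼ) ⟨
        peel i e (λ z → coeffX z (tutte (sliceAt f j) Lⱼ)) z
          ≡⟨ cong₂ (λ b c → peel b c (λ z → coeffX z (tutte (sliceAt f j) Lⱼ)) z)
               (flag j lowest≤highest)
               (trans (flag j ≤-refl) (cong (λ d → ⌊ ∣ d ∣ ℕ.≟ j ⌋) (i≡j⇒i-j≡0 {highest f} refl))) ⟩
        peel ⌊ width f ℕ.≟ j ⌋ ⌊ 0 ℕ.≟ j ⌋ (λ z → coeffX z (tutte (sliceAt f j) Lⱼ)) z ∎
        where
        Lⱼ = slicePoints (level f j) L
        i  = ⌊ level f j ≟ lowest f ⌋
        e  = ⌊ level f j ≟ highest f ⌋
        peel-cong : ∀ i e {t u : ℤ → ℤ} → (∀ z → t z ≡ u z) → peel i e t z ≡ peel i e u z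
        peel-cong true  true  eq = cong₂ _-_ (eq (z - + 1)) (eq z)
        peel-cong true  false eq = eq (z - + 1)
        peel-cong false true  eq = refl
        peel-cong false false eq = eq z

-- The binomial coefficient of an integer

even≢odd : ∀ x y → x * + 2 ≢ + 1 + y * + 2
even≢odd x y eq = two∤one (x - y) (trans (shift x y) (trans (cong (_- y * + 2) eq) (cancel (y * + 2))))
  where
  shift : ∀ x y → (x - y) * + 2 ≡ x * + 2 - y * + 2
  shift = solve-∀
  cancel : ∀ z → + 1 + z - z ≡ + 1
  cancel = solve-∀
  two∤one : ∀ z → z * + 2 ≢ + 1
  two∤one (+ 0)             ()
  two∤one (+ suc z)         ()
  two∤one -[1+ z ]          ()

consecutive-even : ∀ m → ∃ λ t → m * (m - + 1) ≡ t * + 2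
consecutive-even m with m / + 2 | m % + 2 | a≡a%n+[a/n]*n m (+ 2) | n%d<d m (+ 2)
... | q | 0           | refl | _ = q * (q * + 2 - + 1) , shift q
  where
  shift : ∀ q → (+ 0 + q * + 2) * (+ 0 + q * + 2 - + 1) ≡ q * (q * + 2 - + 1) * + 2
  shift = solve-∀
... | q | 1           | refl | _ = (+ 1 + q * + 2) * q , shift q
  where
  shift : ∀ q → (+ 1 + q * + 2) * (+ 1 + q * + 2 - + 1) ≡ (+ 1 + q * + 2) * q * + 2
  shift = solve-∀
... | q | suc (suc r) | _    | ℕ.s≤s (ℕ.s≤s ())

-- The division in `choose2` is exact because one of two consecutive integers is even. Identities
-- for `choose2` can then be checked on doubles, where they are polynomial.
choose2-double : ∀ m → choose2 m * + 2 ≡ m * (m - + 1)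
choose2-double m with m * (m - + 1) | consecutive-even m
... | a | t , a≡2t with a / + 2 | a % + 2 | a≡a%n+[a/n]*n a (+ 2) | n%d<d a (+ 2)
...   | q | 0           | eq | _ = sym (trans eq (+-identityˡ (q * + 2)))
...   | q | 1           | eq | _ = contradiction (trans (sym a≡2t) eq) (even≢odd t q)
...   | q | suc (suc r) | _  | ℕ.s≤s (ℕ.s≤s ())

choose2-unique : ∀ m x → x * + 2 ≡ m * (m - + 1) → x ≡ choose2 m
choose2-unique m x eq = *-cancelʳ-≡ x (choose2 m) (+ 2) (trans eq (sym (choose2-double m)))

choose2-+ : ∀ x y → choose2 (x + y) ≡ choose2 x + choose2 y + x * y
choose2-+ x y = sym (choose2-unique (x + y) _ (trans (distrib (choose2 x) (choose2 y) (x * y))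
  (trans (cong₂ (λ u v → u + v + x * y * + 2) (choose2-double x) (choose2-double y)) (expand x y))))
  where
  distrib : ∀ u v w → (u + v + w) * + 2 ≡ u * + 2 + v * + 2 + w * + 2
  distrib = solve-∀
  expand : ∀ x y → x * (x - + 1) + y * (y - + 1) + x * y * + 2 ≡ (x + y) * (x + y - + 1)
  expand = solve-∀

choose2-suc : ∀ x → choose2 (x + + 1) ≡ choose2 x + x
choose2-suc x = trans (choose2-+ x (+ 1)) (shift (choose2 x) x)
  where
  shift : ∀ c x → c + + 0 + x * + 1 ≡ c + x
  shift = solve-∀

-- Finite sums

foldr-sumBy : ∀ xs → foldr _+_ (+ 0) xs ≡ sumBy (λ x → x) xs
foldr-sumBy xs = cong (foldr _+_ (+ 0)) (sym (List.map-id xs))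

sumPairs-sumBy : ∀ {n} (g : Fin n → Fin n → ℤ) →
  sumPairs g ≡ sumBy (λ j → sumBy (λ i → g i j) (below j)) (allFin n)
sumPairs-sumBy {n} g = trans (foldr-sumBy (concatMap (λ j → map (λ i → g i j) (below j)) (allFin n)))
  (trans (sumBy-concatMap (λ x → x) (λ j → map (λ i → g i j) (below j)) (allFin n))
         (sumBy-cong (allFin n) (λ j → sumBy-map (λ x → x) (λ i → g i j) (below j))))

sumPairs-cong : ∀ {n} {g h : Fin n → Fin n → ℤ} → (∀ i j → g i j ≡ h i j) → sumPairs g ≡ sumPairs h
sumPairs-cong {n} {g} {h} eq = trans (sumPairs-sumBy g)
  (trans (sumBy-cong (allFin n) (λ j → sumBy-cong (below j) (λ i → eq i j))) (sym (sumPairs-sumBy h)))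

sumBy-∷ʳ : ∀ {n} (g : Fin (suc n) → ℤ) → sumBy g (allFin (suc n)) ≡ sumBy (g ∘ inject₁) (allFin n) + g (fromℕ n)
sumBy-∷ʳ {n} g = trans (cong (sumBy g) (allFin-∷ʳ n))
  (trans (sumBy-++ g (map inject₁ (allFin n)) (fromℕ n ∷ []))
         (cong₂ _+_ (sumBy-map g inject₁ (allFin n)) (+-identityʳ (g (fromℕ n)))))

sumPairs-∷ʳ : ∀ {n} (g : Fin (suc n) → Fin (suc n) → ℤ) →
  sumPairs g ≡ sumPairs (λ i j → g (inject₁ i) (inject₁ j)) + sumFin (λ i → g (inject₁ i) (fromℕ n))
sumPairs-∷ʳ {n} g = trans (sumPairs-sumBy g) (trans (sumBy-∷ʳ (λ j → sumBy (λ i → g i j) (below j)))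
  (cong₂ _+_
    (trans (sumBy-cong (allFin n) (λ j → trans (cong (sumBy (λ i → g i (inject₁ j))) (below-inject₁ j))
                                               (sumBy-map (λ i → g i (inject₁ j)) inject₁ (below j))))
           (sym (sumPairs-sumBy (λ i j → g (inject₁ i) (inject₁ j)))))
    (trans (cong (sumBy (λ i → g i (fromℕ n))) (below-fromℕ n))
           (sumBy-map (λ i → g i (fromℕ n)) inject₁ (allFin n)))))

sumBy-const : {A : Set} (c : ℤ) (xs : List A) → sumBy (λ _ → c) xs ≡ + length xs * c
sumBy-const c []       = refl
sumBy-const c (x ∷ xs) = trans (cong (_+_ c) (sumBy-const c xs)) (sym (suc-* (+ length xs) c))

sumFin-const : ∀ n c → sumFin {n} (λ _ → c) ≡ + n * c
sumFin-const n c = trans (sumBy-const c (allFin n)) (cong (λ l → + l * c) (List.length-tabulate {n = n} (λ i → i)))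

sumBy-* : {A : Set} (c : ℤ) (g : A → ℤ) (xs : List A) → sumBy (λ x → c * g x) xs ≡ c * sumBy g xs
sumBy-* c g []       = sym (*-zeroʳ c)
sumBy-* c g (x ∷ xs) = trans (cong (_+_ (c * g x)) (sumBy-* c g xs)) (sym (*-distribˡ-+ c (g x) (sumBy g xs)))

sumUpTo-sumBy : {A : Set} (g : A → ℕ → ℤ) (xs : List A) (N : ℕ) →
  sumUpTo (λ j → sumBy (λ x → g x j) xs) N ≡ sumBy (λ x → sumUpTo (g x) N) xs
sumUpTo-sumBy g []       N = sumUpTo-0 N
sumUpTo-sumBy g (x ∷ xs) N = trans (sumUpTo-+ (g x) (λ j → sumBy (λ x → g x j) xs) N)
  (cong (_+_ (sumUpTo (g x) N)) (sumUpTo-sumBy g xs N))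

sumUpTo-linear : ∀ c N → sumUpTo (λ j → c + + j) N ≡ + N * c + choose2 (+ N)
sumUpTo-linear c zero    = refl
sumUpTo-linear c (suc N) = trans (cong (_+ (c + + N)) (sumUpTo-linear c N))
  (trans (shift c (+ N) (choose2 (+ N)))
         (cong₂ _+_ (cong (_* c) N+1) (trans (sym (choose2-suc (+ N))) (cong choose2 N+1))))
  where
  N+1 : + N + + 1 ≡ + suc N
  N+1 = +-comm (+ N) (+ 1)
  shift : ∀ c N x → N * c + x + (c + N) ≡ (N + + 1) * c + (x + N)
  shift = solve-∀

sumUpTo-const : ∀ c N → sumUpTo (λ _ → c) N ≡ + N * c
sumUpTo-const c zero    = refl
sumUpTo-const c (suc N) = trans (cong (_+ c) (sumUpTo-const c N))
  (trans (+-comm (+ N * c) c) (sym (suc-* (+ N) c)))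

sumUpTo-split : ∀ g M N → sumUpTo g (M ℕ.+ N) ≡ sumUpTo g M + sumUpTo (λ j → g (M ℕ.+ j)) N
sumUpTo-split g M zero    = trans (cong (sumUpTo g) (ℕ.+-identityʳ M)) (sym (+-identityʳ _))
sumUpTo-split g M (suc N) = trans (cong (sumUpTo g) (ℕ.+-suc M N))
  (trans (cong (_+ g (M ℕ.+ N)) (sumUpTo-split g M N))
         (+-assoc (sumUpTo g M) (sumUpTo (λ j → g (M ℕ.+ j)) N) (g (M ℕ.+ N))))

-- The sequence climbs from `x - d` to `x` in unit steps and then stays there; `d ≤ m` lets the sum
-- contain the whole ramp. Against the constant `x` the terms fall short by `d, d - 1, ..., 1`.
-- Subtracting the term at 0 cancels the shortfall `d`, and the remaining `d - 1, ..., 1` add up to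
-- `choose2 d`.
sumUpTo-⊓ : ∀ x {d m} → d ℕ.≤ m →
  sumUpTo (λ j → x ⊓ (x + + j - + d)) m - x ⊓ (x + + 0 - + d) ≡ (+ m - + 1) * x - choose2 (+ d)
sumUpTo-⊓ x {d} {m} d≤m with ℕ.m≤n⇒∃[o]m+o≡n d≤m
... | e , refl = begin
  sumUpTo g (d ℕ.+ e) - g 0
    ≡⟨ cong₂ _-_ (sumUpTo-split g d e) (ramp ℕ.z≤n) ⟩
  sumUpTo g d + sumUpTo (λ j → g (d ℕ.+ j)) e - (x - + d + + 0)
    ≡⟨ cong (_- (x - + d + + 0)) (cong₂ _+_
         (trans (sumUpTo-cong d (ramp ∘ ℕ.<⇒≤)) (sumUpTo-linear (x - + d) d))
         (trans (sumUpTo-cong e (λ {j} _ → plateau j)) (sumUpTo-const x e))) ⟩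
  + d * (x - + d) + choose2 (+ d) + + e * x - (x - + d + + 0)
    ≡⟨ expand x (+ d) (+ e) (choose2 (+ d)) ⟩
  (+ d + + e - + 1) * x + (choose2 (+ d) - + d * (+ d - + 1))
    ≡⟨ cong (λ c → (+ d + + e - + 1) * x + (choose2 (+ d) - c)) (choose2-double (+ d)) ⟨
  (+ d + + e - + 1) * x + (choose2 (+ d) - choose2 (+ d) * + 2)
    ≡⟨ collect ((+ d + + e - + 1) * x) (choose2 (+ d)) ⟩
  (+ (d ℕ.+ e) - + 1) * x - choose2 (+ d) ∎
  where
  g : ℕ → ℤ
  g j = x ⊓ (x + + j - + d)
  shift : ∀ x j d → x + j - d ≡ x - d + j
  shift = solve-∀
  -- Both branches of the minimum agree at `j = d`, so the endpoint is included. The term at 0 is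
  -- then covered even when `d` is 0.
  ramp : ∀ {j} → j ℕ.≤ d → g j ≡ x - + d + + j
  ramp {j} j≤d = trans (i≥j⇒i⊓j≡j (≤-linear (+≤+ j≤d) (diff x (+ j) (+ d)))) (shift x (+ j) (+ d))
    where
    diff : ∀ x j d → x - (x + j - d) ≡ d - j
    diff = solve-∀
  plateau : ∀ j → g (d ℕ.+ j) ≡ x
  plateau j = i≤j⇒i⊓j≡i (≤-linear (+≤+ (ℕ.z≤n {j})) (diff x (+ j) (+ d)))
    where
    diff : ∀ x j d → x + (d + j) - d - x ≡ j - + 0
    diff = solve-∀
  expand : ∀ x d e c → d * (x - d) + c + e * x - (x - d + + 0) ≡ (d + e - + 1) * x + (c - d * (d - + 1))
  expand = solve-∀
  collect : ∀ u c → u + (c - c * + 2) ≡ u - c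
  collect = solve-∀

-- Values of the slice rank functions

single : ∀ {n} → SetFn (suc n) → Fin n → ℤ
single f i = f (⁅ i ⁆ ∷ʳ false)

-- This is `pairSlack` of `i` and the last index, and at the same time the number of levels below
-- the highest after which the rank of `i` in the slice stops growing.
slack : ∀ {n} → SetFn (suc n) → Fin n → ℤ
slack f i = single f i + highest f - f (⁅ i ⁆ ∷ʳ true)

pairSlack : ∀ {n} → SetFn n → Fin n → Fin n → ℤ
pairSlack f i j = f ⁅ i ⁆ + f ⁅ j ⁆ - f (⁅ i ⁆ ∪ ⁅ j ⁆)

module _ {n : ℕ} {f : SetFn (suc n)} (rank : IsRankFn f) where

  private
    module BA = BooleanAlgebra (∪-∩-booleanAlgebra n)

  -- Submodularity for `I` with the last index adjoined and the set of all other indices: their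
  -- union is everything and their intersection is `I`. So the first term attains the minimum.
  slice-lowest : ∀ I → slice f (lowest f) I ≡ f (I ∷ʳ false)
  slice-lowest I = i≤j⇒i⊓j≡i (≤-linear (submodular-∷ʳ {f = f} rank I ⊤ true false)
    (trans (shift (f (I ∷ʳ true)) (f ⊤) (f (⊤ ∷ʳ false)) (f (I ∷ʳ false)))
      (cong₂ (λ u v → f (I ∷ʳ true) + f (⊤ ∷ʳ false) - (u + v))
        (sym (trans (cong (λ J → f (J ∷ʳ true)) (BA.∨-zeroʳ I)) (f-⊤ {f = f} rank)))
        (cong (λ J → f (J ∷ʳ false)) (sym (BA.∧-identityʳ I))))))
    where
    shift : ∀ u r q v → u - (r - q) - v ≡ u + q - (r + v)
    shift = solve-∀

  slack≥0 : ∀ i → + 0 ≤ slack f i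
  slack≥0 i = ≤-linear (submodular-∷ʳ {f = f} rank ⁅ i ⁆ ⊥ false true)
    (trans (shift (single f i + highest f) (f (⁅ i ⁆ ∷ʳ true)))
      (cong₂ (λ u v → single f i + highest f - (u + v))
        (cong (λ J → f (J ∷ʳ true)) (sym (BA.∨-identityʳ ⁅ i ⁆)))
        (sym (trans (cong (λ J → f (J ∷ʳ false)) (BA.∧-zeroʳ ⁅ i ⁆)) (f-⊥ {f = f} rank)))))
    where
    shift : ∀ s u → s - u - + 0 ≡ s - (u + + 0)
    shift = solve-∀

  slack≡ : ∀ i → + ∣ slack f i ∣ ≡ slack f i
  slack≡ i = 0≤i⇒+∣i∣≡i (slack≥0 i)

  -- By `slice-lowest` the rank of `i` has its full value on the lowest level, so the ramp ends no
  -- later than there. This supplies the hypothesis `d ≤ m` of `sumUpTo-⊓`.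
  slack≤width : ∀ i → ∣ slack f i ∣ ℕ.≤ width f
  slack≤width i = drop‿+≤+ (subst₂ _≤_ (sym (slack≡ i)) (sym (width≡ {f = f} rank))
    (≤-linear (i⊓j≡i⇒i≤j (slice-lowest ⁅ i ⁆))
      (shift (highest f) (lowest f) (single f i) (f (⁅ i ⁆ ∷ʳ true)))))
    where
    shift : ∀ b a x u → b - a - (x + b - u) ≡ u - a - x
    shift = solve-∀

  sliceAt-⁅⁆ : ∀ j i → sliceAt f j ⁅ i ⁆ ≡ single f i ⊓ (single f i + + j - + ∣ slack f i ∣)
  sliceAt-⁅⁆ j i = cong (single f i ⊓_) (trans (shift (f (⁅ i ⁆ ∷ʳ true)) (highest f) (+ j) (single f i))
    (cong (_-_ (single f i + + j)) (sym (slack≡ i))))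
    where
    shift : ∀ u b j x → u - (b - j) ≡ x + j - (x + b - u)
    shift = solve-∀

  sliceAt-⊤ : ∀ {j} → j ℕ.≤ width f → sliceAt f j ⊤ ≡ f ⊤ - highest f + + j
  sliceAt-⊤ {j} j≤m = trans (slice-⊤ {f = f} rank (lowest≤level {f = f} rank j≤m)) (shift (f ⊤) (highest f) (+ j))
    where
    shift : ∀ r b j → r - (b - j) ≡ r - b + j
    shift = solve-∀

  sliceAt-width : ∀ I → sliceAt f (width f) I ≡ f (I ∷ʳ false)
  sliceAt-width I = trans (cong (λ k → slice f k I) (trans (cong (_-_ (highest f)) (width≡ {f = f} rank))
    (cancel (highest f) (lowest f)))) (slice-lowest I)
    where
    cancel : ∀ b c → b - (b - c) ≡ c
    cancel = solve-∀

  sumFin-⁅⁆ : sumFin (λ i → f ⁅ i ⁆) ≡ sumFin (single f) + highest f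
  sumFin-⁅⁆ = trans (sumBy-∷ʳ (λ i → f ⁅ i ⁆))
    (cong₂ _+_ (sumBy-cong (allFin n) (λ i → cong f (⁅inject₁⁆ i))) (cong f (⁅fromℕ⁆ n)))

  -- The split mirrors the recursion: pairs avoiding the last index are accounted for by the lowest
  -- slice, whose rank function is `f` on sets without that index, and pairs containing it by the
  -- sum over the levels.
  sumPairs-slack : sumPairs (λ i j → choose2 (pairSlack f i j))
    ≡ sumPairs (λ i j → choose2 (pairSlack (sliceAt f (width f)) i j))
      + sumFin (λ i → choose2 (slack f i))
  sumPairs-slack = trans (sumPairs-∷ʳ (λ i j → choose2 (pairSlack f i j)))
    (cong₂ _+_ (sumPairs-cong λ i j → cong choose2 (below-n i j))
               (sumBy-cong (allFin n) λ i → cong choose2 (with-n i)))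
    where
    below-n : ∀ i j → pairSlack f (inject₁ i) (inject₁ j) ≡ pairSlack (sliceAt f (width f)) i j
    below-n i j = cong₂ _-_
      (cong₂ _+_ (trans (cong f (⁅inject₁⁆ i)) (sym (sliceAt-width ⁅ i ⁆)))
                 (trans (cong f (⁅inject₁⁆ j)) (sym (sliceAt-width ⁅ j ⁆))))
      (trans (cong f (trans (cong₂ _∪_ (⁅inject₁⁆ i) (⁅inject₁⁆ j)) (zipWith-∷ʳ _∨_ ⁅ i ⁆ ⁅ j ⁆ false false)))
             (sym (sliceAt-width (⁅ i ⁆ ∪ ⁅ j ⁆))))
    with-n : ∀ i → pairSlack f (inject₁ i) (fromℕ n) ≡ slack f i
    with-n i = cong₂ _-_
      (cong₂ _+_ (cong f (⁅inject₁⁆ i)) (cong f (⁅fromℕ⁆ n)))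
      (cong f (trans (cong₂ _∪_ (⁅inject₁⁆ i) (⁅fromℕ⁆ n))
        (trans (zipWith-∷ʳ _∨_ ⁅ i ⁆ ⊥ false true) (cong (_∷ʳ true) (BA.∨-identityʳ ⁅ i ⁆)))))

-- The four leading coefficients of the Tutte polynomial at y = 0

Enumerates₀ : ∀ {f : SetFn 0} → IsRankFn f → ∀ {L} → Enumerates f L → L ≡ [] ∷ []
Enumerates₀ {f} rank {[]} (_ , iff) with Equivalence.from (iff []) origin∈P
  where
  origin∈P : InP f []
  origin∈P = ≤⇒InP (λ { [] → ≤-reflexive (sym (proj₁ rank)) }) (sym (proj₁ rank))
... | ()
Enumerates₀ rank {[] ∷ []}     _                        = refl
Enumerates₀ rank {[] ∷ [] ∷ _} (((neq ∷ _) ∷ _) , _)    = contradiction refl neq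

-- The degree bound at `y = 0`. The excess over the dimension is a parameter because the slice
-- multiplied by `x` keeps the same excess, while the other slices have an excess larger by one.
coeffX>n : ∀ {n} {f : SetFn n} → IsRankFn f → ∀ {L} → Enumerates f L → ∀ s →
  coeffX (+ n + + suc s) (tutte f L) ≡ + 0
coeffX>n {zero}  rank enum s rewrite Enumerates₀ rank enum = refl
coeffX>n {suc n} {f} rank {L} enum s = begin
  coeffX z (tutte f L)
    ≡⟨ coeffX-tutte-slices rank enum z ⟩
  coeffX (z - + 1) (T (width f)) + sumUpTo (λ j → coeffX z (T j)) (width f) - coeffX z (T 0)
    ≡⟨ cong₂ _-_ (cong₂ _+_ (trans (cong (λ z → coeffX z (T (width f))) (lower (+ n) (+ suc s)))
                                   (vanish ℕ.≤-refl s))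
                            (trans (sumUpTo-cong (width f) (λ {j} j<m → vanish′ (ℕ.<⇒≤ j<m))) (sumUpTo-0 (width f))))
                 (vanish′ ℕ.z≤n) ⟩
  + 0 ∎
  where
  z = + suc n + + suc s
  T : ℕ → Poly
  T j = tutte (sliceAt f j) (slicePoints (level f j) L)
  lower : ∀ N s → + 1 + N + s - + 1 ≡ N + s
  lower = solve-∀
  raise : ∀ N s → + 1 + N + s ≡ N + (+ 1 + s)
  raise = solve-∀
  vanish : ∀ {j} → j ℕ.≤ width f → ∀ s → coeffX (+ n + + suc s) (T j) ≡ + 0
  vanish {j} j≤m = coeffX>n (sliceAt-rank {f = f} rank j) (sliceAt-Enumerates rank enum j≤m)
  vanish′ : ∀ {j} → j ℕ.≤ width f → coeffX z (T j) ≡ + 0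
  vanish′ {j} j≤m = trans (cong (λ z → coeffX z (T j)) (raise (+ n) (+ suc s))) (vanish j≤m (suc s))

-- Only the lowest slice reaches the top degree, through its factor `x`; the others are too small in
-- dimension.
coeffX-n : ∀ {n} {f : SetFn n} → IsRankFn f → ∀ {L} → Enumerates f L → coeffX (+ n) (tutte f L) ≡ + 1
coeffX-n {zero}  rank enum rewrite Enumerates₀ rank enum = refl
coeffX-n {suc n} {f} rank {L} enum = begin
  coeffX (+ suc n) (tutte f L)
    ≡⟨ coeffX-tutte-slices rank enum (+ suc n) ⟩
  coeffX (+ suc n - + 1) (T (width f)) + sumUpTo (λ j → coeffX (+ suc n) (T j)) (width f) - coeffX (+ suc n) (T 0)
    ≡⟨ cong₂ _-_ (cong₂ _+_ (trans (cong (λ z → coeffX z (T (width f))) (lower (+ n)))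
                                   (coeffX-n (sliceAt-rank {f = f} rank (width f)) (sliceAt-Enumerates rank enum ℕ.≤-refl)))
                            (trans (sumUpTo-cong (width f) (λ {j} j<m → vanish (ℕ.<⇒≤ j<m))) (sumUpTo-0 (width f))))
                 (vanish ℕ.z≤n) ⟩
  + 1 ∎
  where
  T : ℕ → Poly
  T j = tutte (sliceAt f j) (slicePoints (level f j) L)
  lower : ∀ N → + 1 + N - + 1 ≡ N
  lower = solve-∀
  vanish : ∀ {j} → j ℕ.≤ width f → coeffX (+ suc n) (T j) ≡ + 0
  vanish {j} j≤m = trans (cong (λ z → coeffX z (T j)) (+-comm (+ 1) (+ n)))
    (coeffX>n (sliceAt-rank {f = f} rank j) (sliceAt-Enumerates rank enum j≤m) 0)

-- With `m` the width, the total of the lowest slice is `f ⊤ - highest f + m`. The remaining slices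
-- contribute their leading coefficient 1, in all `m - 1` times: the `m` cancels, and the `-1`
-- accounts for the added dimension.
coeffX-n-1 : ∀ {n} {f : SetFn n} → IsRankFn f → ∀ {L} → Enumerates f L →
  coeffX (+ n - + 1) (tutte f L) ≡ sumFin (λ i → f ⁅ i ⁆) - f ⊤ - + n
coeffX-n-1 {zero}  rank enum = cong (λ r → + 0 - r - + 0) (sym (proj₁ rank))
coeffX-n-1 {suc n} {f} rank {L} enum = begin
  coeffX (+ suc n - + 1) (tutte f L)
    ≡⟨ coeffX-tutte-slices rank enum (+ suc n - + 1) ⟩
  coeffX (+ suc n - + 1 - + 1) (T m) + sumUpTo (λ j → coeffX (+ suc n - + 1) (T j)) m - coeffX (+ suc n - + 1) (T 0)
    ≡⟨ cong₂ _-_ (cong₂ _+_ top (trans (sumUpTo-cong m (λ {j} j<m → one (ℕ.<⇒≤ j<m))) (sumUpTo-const (+ 1) m)))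
                 (one ℕ.z≤n) ⟩
  sumFin (single f) - (f ⊤ - highest f + + m) - + n + + m * + 1 - + 1
    ≡⟨ collect (sumFin (single f)) (f ⊤) (highest f) (+ m) (+ n) ⟩
  sumFin (single f) + highest f - f ⊤ - + suc n
    ≡⟨ cong (λ s → s - f ⊤ - + suc n) (sumFin-⁅⁆ {f = f} rank) ⟨
  sumFin (λ i → f ⁅ i ⁆) - f ⊤ - + suc n ∎
  where
  m = width f
  T : ℕ → Poly
  T j = tutte (sliceAt f j) (slicePoints (level f j) L)
  lower : ∀ N → + 1 + N - + 1 ≡ N
  lower = solve-∀
  collect : ∀ A r b m N → A - (r - b + m) - N + m * + 1 - + 1 ≡ A + b - r - (+ 1 + N)
  collect = solve-∀
  one : ∀ {j} → j ℕ.≤ m → coeffX (+ suc n - + 1) (T j) ≡ + 1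
  one {j} j≤m = trans (cong (λ z → coeffX z (T j)) (lower (+ n)))
    (coeffX-n (sliceAt-rank {f = f} rank j) (sliceAt-Enumerates rank enum j≤m))
  top : coeffX (+ suc n - + 1 - + 1) (T m) ≡ sumFin (single f) - (f ⊤ - highest f + + m) - + n
  top = begin
    coeffX (+ suc n - + 1 - + 1) (T m)
      ≡⟨ cong (λ z → coeffX (z - + 1) (T m)) (lower (+ n)) ⟩
    coeffX (+ n - + 1) (T m)
      ≡⟨ coeffX-n-1 (sliceAt-rank {f = f} rank m) (sliceAt-Enumerates rank enum ℕ.≤-refl) ⟩
    sumFin (λ i → sliceAt f m ⁅ i ⁆) - sliceAt f m ⊤ - + n
      ≡⟨ cong₂ (λ s r → s - r - + n) (sumBy-cong (allFin n) (λ i → sliceAt-width {f = f} rank ⁅ i ⁆))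
                                      (sliceAt-⊤ {f = f} rank ℕ.≤-refl) ⟩
    sumFin (single f) - (f ⊤ - highest f + + m) - + n ∎

coeffX-n-2 : ∀ {n} {f : SetFn n} → IsRankFn f → ∀ {L} → Enumerates f L →
  coeffX (+ n - + 2) (tutte f L)
  ≡ choose2 (sumFin (λ i → f ⁅ i ⁆) - f ⊤ + + 1 - + n) - sumPairs (λ i j → choose2 (pairSlack f i j))
-- The exponent is -2, so the left side is 0 by definition. On the right `f ⊤` is also `f ⊥`, hence
-- 0, and `choose2` vanishes at 1.
coeffX-n-2 {zero}  rank enum = cong (λ r → choose2 (+ 0 - r + + 1 - + 0) - + 0) (sym (proj₁ rank))
coeffX-n-2 {suc n} {f} rank {L} enum = begin
  coeffX (+ suc n - + 2) (tutte f L)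
    ≡⟨ coeffX-tutte-slices rank enum (+ suc n - + 2) ⟩
  coeffX (+ suc n - + 2 - + 1) (T m) + sumUpTo (λ j → coeffX (+ suc n - + 2) (T j)) m - coeffX (+ suc n - + 2) (T 0)
    ≡⟨ cong₂ _-_ (cong₂ _+_ top (sumUpTo-cong m (λ {j} j<m → next (ℕ.<⇒≤ j<m)))) (next ℕ.z≤n) ⟩
  choose2 (A - (r - β + + m) + + 1 - N) - pairs + sumUpTo (λ j → G j + H j) m - (G 0 + H 0)
    ≡⟨ cong (λ s → choose2 (A - (r - β + + m) + + 1 - N) - pairs + s - (G 0 + H 0)) (sumUpTo-+ G H m) ⟩
  choose2 (A - (r - β + + m) + + 1 - N) - pairs + (sumUpTo G m + sumUpTo H m) - (G 0 + H 0)
    ≡⟨ regroup (choose2 (A - (r - β + + m) + + 1 - N)) pairs (sumUpTo G m) (sumUpTo H m) (G 0) (H 0) ⟩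
  choose2 (A - (r - β + + m) + + 1 - N) + (sumUpTo H m - H 0) - pairs + (sumUpTo G m - G 0)
    ≡⟨ cong₂ (λ h g → choose2 (A - (r - β + + m) + + 1 - N) + (h - H 0) - pairs + g)
         (trans (sumUpTo-cong m (λ {j} _ → linear (r - β) (+ j) N))
         (trans (sumUpTo-+ (λ _ → c) (λ j → - (+ j)) m)
                (cong₂ _+_ (sumUpTo-const c m) (sumUpTo-neg m))))
         sumG ⟩
  choose2 (A - (r - β + + m) + + 1 - N) + (+ m * c - choose2 (+ m) - H 0) - pairs + ((+ m - + 1) * A - slacks)
    ≡⟨ regroup′ (choose2 (A - (r - β + + m) + + 1 - N)) (+ m * c - choose2 (+ m) - H 0) pairs
                ((+ m - + 1) * A) slacks ⟩
  choose2 (A - (r - β + + m) + + 1 - N) + (+ m * c - choose2 (+ m) - H 0) + (+ m - + 1) * A - (pairs + slacks)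
    ≡⟨ cong (_- (pairs + slacks)) collect ⟩
  choose2 (A + β - r + + 1 - + suc n) - (pairs + slacks)
    ≡⟨ cong₂ (λ s p → choose2 (s - r + + 1 - + suc n) - p) (sumFin-⁅⁆ {f = f} rank) (sumPairs-slack {f = f} rank) ⟨
  choose2 (sumFin (λ i → f ⁅ i ⁆) - f ⊤ + + 1 - + suc n) - sumPairs (λ i j → choose2 (pairSlack f i j)) ∎
  where
  m = width f
  N = + n
  A = sumFin (single f)
  r = f ⊤
  β = highest f
  c = - (r - β) - N
  pairs = sumPairs (λ i j → choose2 (pairSlack (sliceAt f m) i j))
  slacks = sumFin (λ i → choose2 (slack f i))
  T : ℕ → Poly
  T j = tutte (sliceAt f j) (slicePoints (level f j) L)
  -- The coefficient taken from the slice on level `j` splits into `G j`, a sum of ramps in `j`, and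
  -- `H j`, which is affine in `j`.
  G H : ℕ → ℤ
  G j = sumFin (λ i → sliceAt f j ⁅ i ⁆)
  H j = - (r - β + + j) - N

  lower : ∀ N → + 1 + N - + 2 - + 1 ≡ N - + 2
  lower = solve-∀
  raise : ∀ N → + 1 + N - + 2 ≡ N - + 1
  raise = solve-∀
  linear : ∀ u j N → - (u + j) - N ≡ - u - N + - j
  linear = solve-∀
  regroup : ∀ x p g h g₀ h₀ → x - p + (g + h) - (g₀ + h₀) ≡ x + (h - h₀) - p + (g - g₀)
  regroup = solve-∀
  regroup′ : ∀ x y p a s → x + y - p + (a - s) ≡ x + y + a - (p + s)
  regroup′ = solve-∀

  top : coeffX (+ suc n - + 2 - + 1) (T m) ≡ choose2 (A - (r - β + + m) + + 1 - N) - pairs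
  top = begin
    coeffX (+ suc n - + 2 - + 1) (T m)
      ≡⟨ cong (λ z → coeffX z (T m)) (lower N) ⟩
    coeffX (N - + 2) (T m)
      ≡⟨ coeffX-n-2 (sliceAt-rank {f = f} rank m) (sliceAt-Enumerates rank enum ℕ.≤-refl) ⟩
    choose2 (sumFin (λ i → sliceAt f m ⁅ i ⁆) - sliceAt f m ⊤ + + 1 - N) - pairs
      ≡⟨ cong₂ (λ s r → choose2 (s - r + + 1 - N) - pairs)
           (sumBy-cong (allFin n) (λ i → sliceAt-width {f = f} rank ⁅ i ⁆)) (sliceAt-⊤ {f = f} rank ℕ.≤-refl) ⟩
    choose2 (A - (r - β + + m) + + 1 - N) - pairs ∎

  next : ∀ {j} → j ℕ.≤ m → coeffX (+ suc n - + 2) (T j) ≡ G j + H j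
  next {j} j≤m = begin
    coeffX (+ suc n - + 2) (T j)
      ≡⟨ cong (λ z → coeffX z (T j)) (raise N) ⟩
    coeffX (N - + 1) (T j)
      ≡⟨ coeffX-n-1 (sliceAt-rank {f = f} rank j) (sliceAt-Enumerates rank enum j≤m) ⟩
    G j - sliceAt f j ⊤ - N
      ≡⟨ cong (λ r → G j - r - N) (sliceAt-⊤ {f = f} rank j≤m) ⟩
    G j - (r - β + + j) - N
      ≡⟨ +-assoc (G j) (- (r - β + + j)) (- N) ⟩
    G j + H j ∎

  sumUpTo-neg : ∀ M → sumUpTo (λ j → - (+ j)) M ≡ - choose2 (+ M)
  sumUpTo-neg zero    = refl
  sumUpTo-neg (suc M) = trans (cong (_- + M) (sumUpTo-neg M)) (trans (sym (neg-distrib-+ (choose2 (+ M)) (+ M)))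
    (cong (λ x → - x) (trans (sym (choose2-suc (+ M))) (cong choose2 (+-comm (+ M) (+ 1))))))

  -- Exchanging the sum over levels with the sum over indices leaves one ramp for each `i`, and its
  -- deficit is the binomial of the pair of `i` and the last index.
  sumG : sumUpTo G m - G 0 ≡ (+ m - + 1) * A - slacks
  sumG = begin
    sumUpTo G m - G 0
      ≡⟨ cong₂ _+_ (sumUpTo-sumBy (λ i j → sliceAt f j ⁅ i ⁆) (allFin n) m)
                   (sym (sumBy-neg (λ i → sliceAt f 0 ⁅ i ⁆) (allFin n))) ⟩
    sumFin (λ i → sumUpTo (λ j → sliceAt f j ⁅ i ⁆) m) + sumFin (λ i → - sliceAt f 0 ⁅ i ⁆)
      ≡⟨ sumBy-+ (λ i → sumUpTo (λ j → sliceAt f j ⁅ i ⁆) m) (λ i → - sliceAt f 0 ⁅ i ⁆) (allFin n) ⟨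
    sumFin (λ i → sumUpTo (λ j → sliceAt f j ⁅ i ⁆) m - sliceAt f 0 ⁅ i ⁆)
      ≡⟨ sumBy-cong (allFin n) ramp ⟩
    sumFin (λ i → (+ m - + 1) * single f i - choose2 (slack f i))
      ≡⟨ sumBy-+ (λ i → (+ m - + 1) * single f i) (λ i → - choose2 (slack f i)) (allFin n) ⟩
    sumFin (λ i → (+ m - + 1) * single f i) + sumFin (λ i → - choose2 (slack f i))
      ≡⟨ cong₂ _+_ (sumBy-* (+ m - + 1) (single f) (allFin n)) (sumBy-neg (λ i → choose2 (slack f i)) (allFin n)) ⟩
    (+ m - + 1) * A - slacks ∎
    where
    ramp : ∀ i → sumUpTo (λ j → sliceAt f j ⁅ i ⁆) m - sliceAt f 0 ⁅ i ⁆
               ≡ (+ m - + 1) * single f i - choose2 (slack f i)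
    ramp i = trans
      (cong₂ _-_ (sumUpTo-cong m (λ {j} _ → sliceAt-⁅⁆ {f = f} rank j i)) (sliceAt-⁅⁆ {f = f} rank 0 i))
      (trans (sumUpTo-⊓ (single f i) (slack≤width {f = f} rank i))
             (cong (λ d → (+ m - + 1) * single f i - choose2 d) (slack≡ {f = f} rank i)))

  collect : choose2 (A - (r - β + + m) + + 1 - N) + (+ m * c - choose2 (+ m) - H 0) + (+ m - + 1) * A
          ≡ choose2 (A + β - r + + 1 - + suc n)
  collect = begin
    choose2 (A - (r - β + + m) + + 1 - N) + (+ m * c - choose2 (+ m) - H 0) + (+ m - + 1) * A
      ≡⟨ cong (λ x → x + (+ m * c - choose2 (+ m) - H 0) + (+ m - + 1) * A)
           (trans (cong choose2 (offset A r β (+ m) N)) (choose2-suc s)) ⟩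
    choose2 s + s + (+ m * c - choose2 (+ m) - H 0) + (+ m - + 1) * A
      ≡⟨ expand A r β (+ m) N (choose2 s) (choose2 (+ m)) ⟩
    choose2 s + + m * s + + m * (+ m - + 1) - choose2 (+ m)
      ≡⟨ cong (λ x → choose2 s + + m * s + x - choose2 (+ m)) (choose2-double (+ m)) ⟨
    choose2 s + + m * s + choose2 (+ m) * + 2 - choose2 (+ m)
      ≡⟨ simplify (choose2 s) (+ m) s (choose2 (+ m)) ⟩
    choose2 s + choose2 (+ m) + s * + m
      ≡⟨ choose2-+ s (+ m) ⟨
    choose2 (s + + m)
      ≡⟨ cong choose2 (target A r β (+ m) N) ⟩
    choose2 (A + β - r + + 1 - + suc n) ∎
    where
    -- The coefficient of the lowest slice one below its leading one. Its binomial has argument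
    -- `s + 1` and the target has argument `s + m`; the affine parts of the level sums make up the
    -- difference, by the addition formula `choose2-+`.
    s = A - (r - β + + m) - N
    offset : ∀ A r b m N → A - (r - b + m) + + 1 - N ≡ A - (r - b + m) - N + + 1
    offset = solve-∀
    target : ∀ A r b m N → A - (r - b + m) - N + m ≡ A + b - r + + 1 - (+ 1 + N)
    target = solve-∀
    expand : ∀ A r b m N x y →
      x + (A - (r - b + m) - N) + (m * (- (r - b) - N) - y - (- (r - b + + 0) - N)) + (m - + 1) * A
      ≡ x + m * (A - (r - b + m) - N) + m * (m - + 1) - y
    expand = solve-∀
    simplify : ∀ x m s y → x + m * s + y * + 2 - y ≡ x + y + s * m
    simplify = solve-∀

-- Duality exchanges x and y

negate-involutive : ∀ {n} (a : Vec ℤ n) → negate (negate a) ≡ a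
negate-involutive a = trans (sym (Vec.map-∘ (λ x → - x) (λ x → - x) a))
  (trans (Vec.map-cong neg-involutive a) (Vec.map-id a))

dual-Enumerates : ∀ {n} {f : SetFn n} → IsRankFn f → ∀ {L} → Enumerates f L → Enumerates (dual f) (map negate L)
dual-Enumerates {f = f} rank {L} (unique , iff) =
  Unique.map⁺ (λ {a} {b} eq → trans (sym (negate-involutive a)) (trans (cong negate eq) (negate-involutive b))) unique ,
  λ a → mk⇔ (to a) (from a)
  where
  to : ∀ a → a ∈ map negate L → InP (dual f) a
  to a a∈ with ∈-map⁻ negate a∈
  ... | b , b∈ , refl = InP⇒InP-dual rank (Equivalence.to (iff b) b∈)
  from : ∀ a → InP (dual f) a → a ∈ map negate L
  from a a∈P = subst (_∈ map negate L) (negate-involutive a) (∈-map⁺ negate (Equivalence.from (iff (negate a))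
    (InP-dual⇒InP rank (subst (InP (dual f)) (sym (negate-involutive a)) a∈P))))

-- Two exchanges compensate each other: `coeffY-term` swaps the variables, and negation swaps the
-- activities at each point.
coeffY-tutte-dual : ∀ {n} {f : SetFn n} → IsRankFn f → ∀ z L →
  coeffY z (tutte f L) ≡ coeffX z (tutte (dual f) (map negate L))
coeffY-tutte-dual {n} {f} rank z L = begin
  coeffY z (tutte f L)                                      ≡⟨ coeffY-tutte z f L ⟩
  sumBy (coeffY z ∘ tutteTerm f) L                          ≡⟨ sumBy-cong L termwise ⟩
  sumBy (coeffX z ∘ tutteTerm (dual f) ∘ negate) L          ≡⟨ sumBy-map (coeffX z ∘ tutteTerm (dual f)) negate L ⟨
  sumBy (coeffX z ∘ tutteTerm (dual f)) (map negate L)      ≡⟨ coeffX-tutte z (dual f) (map negate L) ⟨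
  coeffX z (tutte (dual f) (map negate L)) ∎
  where
  counts : ∀ a (g : Bool → Bool → Bool) → countB (λ i → g (extAct f a i) (intAct f a i))
    ≡ countB (λ i → g (intAct (dual f) (negate a) i) (extAct (dual f) (negate a) i))
  counts a g = countB-cong (λ i → cong₂ g (sym (intAct-dual rank a i)) (sym (extAct-dual rank a i)))
  termwise : ∀ a → coeffY z (tutteTerm f a) ≡ coeffX z (tutteTerm (dual f) (negate a))
  termwise a = trans
    (coeffY-term z (countB (λ i → intAct f a i ∧ not (extAct f a i))) (countB (λ i → extAct f a i ∧ not (intAct f a i)))
      (countB (λ i → intAct f a i ∧ extAct f a i)))
    (cong (coeffX z) (cong₃ term
      (counts a (λ e i → e ∧ not i))
      (counts a (λ e i → i ∧ not e))
      (trans (countB-cong (λ i → Bool.∧-comm (intAct f a i) (extAct f a i))) (counts a _∧_))))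

-- Each value of `dual f` carries the correction `- f ⊤`. It occurs `n` times among the singletons
-- and once, with opposite sign, in the total, whence the factor `n - 1`. In the slack of a pair it
-- occurs twice against once, so a single `f ⊤` is left.
coeffY-n-2 : ∀ {n} {f : SetFn n} → IsRankFn f → ∀ {L} → Enumerates f L →
  coeffY (+ n - + 2) (tutte f L)
  ≡ choose2 (sumFin (λ i → f (minus1 i)) - (+ n - + 1) * f ⊤ + + 1 - + n)
    - sumPairs (λ i j → choose2 (f (minus1 i) + f (minus1 j) - f (minus2 i j) - f ⊤))
coeffY-n-2 {n} {f} rank {L} enum = begin
  coeffY (+ n - + 2) (tutte f L)
    ≡⟨ coeffY-tutte-dual rank (+ n - + 2) L ⟩
  coeffX (+ n - + 2) (tutte (dual f) (map negate L))
    ≡⟨ coeffX-n-2 (dual-rank {f = f} rank) (dual-Enumerates rank enum) ⟩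
  choose2 (sumFin (λ i → dual f ⁅ i ⁆) - dual f ⊤ + + 1 - + n) - sumPairs (λ i j → choose2 (pairSlack (dual f) i j))
    ≡⟨ cong₂ (λ x p → choose2 x - p) singles
         (sumPairs-cong (λ i j → cong choose2 (shift (f (minus1 i)) (f (minus1 j)) (f (minus2 i j)) (f ⊤)))) ⟩
  choose2 (sumFin (λ i → f (minus1 i)) - (+ n - + 1) * f ⊤ + + 1 - + n)
    - sumPairs (λ i j → choose2 (f (minus1 i) + f (minus1 j) - f (minus2 i j) - f ⊤)) ∎
  where
  shift : ∀ u v w r → u - r + (v - r) - (w - r) ≡ u + v - w - r
  shift = solve-∀
  collect : ∀ s N r → s + N * (- r) - - r + + 1 - N ≡ s - (N - + 1) * r + + 1 - N
  collect = solve-∀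
  singles : sumFin (λ i → dual f ⁅ i ⁆) - dual f ⊤ + + 1 - + n
          ≡ sumFin (λ i → f (minus1 i)) - (+ n - + 1) * f ⊤ + + 1 - + n
  singles = trans
    (cong₂ (λ s r → s - r + + 1 - + n)
      (trans (sumBy-+ (λ i → f (minus1 i)) (λ _ → - f ⊤) (allFin n))
             (cong (_+_ (sumFin (λ i → f (minus1 i)))) (sumFin-const n (- f ⊤))))
      (dual-⊤ {f = f} rank))
    (collect (sumFin (λ i → f (minus1 i))) (+ n) (f ⊤))

theorem5p4 : (n : ℕ) (f : Subset n → ℤ) → IsRankFn f →
    (L : List (Vec ℤ n)) → Enumerates f L →
    (coeffX (+ n - + 2) (tutte f L)
    ≡ choose2 (sumFin (λ i → f ⁅ i ⁆) - f ⊤ + + 1 - + n)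
    - sumPairs (λ i j → choose2 (f ⁅ i ⁆ + f ⁅ j ⁆ - f (⁅ i ⁆ ∪ ⁅ j ⁆))))
    × (coeffY (+ n - + 2) (tutte f L)
    ≡ choose2 (sumFin (λ i → f (minus1 i)) - (+ n - + 1) * f ⊤ + + 1 - + n)
    - sumPairs (λ i j → choose2 (f (minus1 i) + f (minus1 j) - f (minus2 i j) - f ⊤)))
theorem5p4 n f rank L enum = coeffX-n-2 rank enum , coeffY-n-2 rank enum
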